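{- Let $0\le \ell\le k$. A graph $G$ is a $(k,\ell)$-pebble-game graph that is $(k,\ell)$-tight if and only if $G$ is a $(k,\ell)$-maps-and-trees.
   Context: A graph means a finite multigraph, possibly with loops. A graph is $(k,\ell)$-sparse if every subgraph with $n'$ vertices and $m'\ge1$ edges has $m'\le kn'-\ell$. It is $(k,\ell)$-tight if it is $(k,\ell)$-sparse and has exactly $kn-\ell$ edges, where $n$ is its number of vertices. A map-graph is a graph admitting an orientation in which every vertex has out-degree exactly one. A graph $G$ is a $(k,\ell)$-maps-and-trees if its edge set can be partitioned into $\ell$ spanning trees of $G$ and $k-\ell$ spanning subgraphs of $G$ that are map-graphs. The $(k,\ell)$-pebble game with colors is played on a fixed finite vertex set $V$. Its state is a directed multigraph $H$ on $V$ (loops allowed) together with pebbles, each having one of $k$ colors $c_1,\dots,c_k$. Each pebble lies on a vertex or on an edge, and every edge carries exactly one pebble. Initially $H$ has no edges and each vertex carries one pebble of each color. Moves: (add-edge) Let $v,w$ be vertices, not necessarily distinct, whose set $\{v,w\}$ carries at least $\ell+1$ pebbles in total, with $v$ carrying at least one pebble. Pick up a pebble from $v$, add the directed edge $vw$, and put that pebble on it. (pebble-slide) Let $w$ carry a pebble $p$ and let $vw$ be an edge. Replace $vw$ by $wv$, put the pebble from $vw$ onto $v$, and put $p$ on $wv$. $G$ is a $(k,\ell)$-pebble-game graph if it is the underlying undirected graph of some $H$ reachable from the initial configuration on $V(G)$ by finitely many moves. -}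

module Defs where

open import Data.Nat using (ℕ; zero; suc; _+_; _*_; _≤_; _<_)
open import Data.Fin using (Fin; zero; suc; toℕ; fromℕ; inject₁; _≟_)
open import Data.Fin.Subset using (Subset; _∈_; ∣_∣)
open import Data.Product using (Σ; _×_; _,_; ∃; proj₁; proj₂)
open import Data.Sum using (_⊎_)
open import Data.Bool using (Bool; true; false; _∧_; if_then_else_)
open import Data.List using (List; []; _∷_; length; lookup)
open import Data.List.Base using (_[_]∷=_)
open import Relation.Nullary using (¬_)
open import Relation.Nullary.Decidable using (⌊_⌋)
open import Relation.Binary.PropositionalEquality using (_≡_)
open import Relation.Binary.Construct.Closure.ReflexiveTransitive using (Star)
open import Function.Definitions using (Injective)
open import Function.Bundles using (_↔_; Inverse)

-- Finite multigraphs with loops on the vertex set Fin n.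
-- Edges are indexed by Fin m; edge e joins the two vertices of ends e
-- (the order of the pair is irrelevant: the graph is undirected).

record Graph (n : ℕ) : Set where
  field
    m    : ℕ
    ends : Fin m → Fin n × Fin n
open Graph public

Joins : ∀ {n} (G : Graph n) → Fin (m G) → Fin n → Fin n → Set
Joins G e a b = ends G e ≡ (a , b) ⊎ ends G e ≡ (b , a)

EdgeSet : ∀ {n} → Graph n → Set₁
EdgeSet G = Fin (m G) → Set

IsSubgraph : ∀ {n} (G : Graph n) → Subset n → Subset (m G) → Set
IsSubgraph G S F = ∀ e → e ∈ F → proj₁ (ends G e) ∈ S × proj₂ (ends G e) ∈ S

-- (k,ℓ)-sparse: every subgraph with n' vertices and m' ≥ 1 edges has
-- m' ≤ k n' - ℓ (read over the integers, i.e. m' + ℓ ≤ k n').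
Sparse : ℕ → ℕ → ∀ {n} → Graph n → Set
Sparse k ℓ {n} G = ∀ (S : Subset n) (F : Subset (m G)) → IsSubgraph G S F →
                   1 ≤ ∣ F ∣ → ∣ F ∣ + ℓ ≤ k * ∣ S ∣

Tight : ℕ → ℕ → ∀ {n} → Graph n → Set
Tight k ℓ {n} G = Sparse k ℓ G × (m G + ℓ ≡ k * n)

record Walk {n} (G : Graph n) (F : EdgeSet G) (u v : Fin n) : Set where
  field
    len   : ℕ
    vs    : Fin (suc len) → Fin n
    es    : Fin len → Fin (m G)
    start : vs zero ≡ u
    end   : vs (fromℕ len) ≡ v
    inF   : ∀ i → F (es i)
    joins : ∀ i → Joins G (es i) (vs (inject₁ i)) (vs (suc i))
open Walk public

-- a cycle in F: a closed walk of length ≥ 1 with pairwise distinct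
-- edges and pairwise distinct vertices v₀ … v_{len-1}
-- (a loop is a cycle of length 1, two parallel edges one of length 2)
HasCycle : ∀ {n} (G : Graph n) → EdgeSet G → Set
HasCycle {n} G F = Σ (Fin n) λ v → Σ (Walk G F v v) λ w →
  (1 ≤ len w) × Injective _≡_ _≡_ (es w) × Injective _≡_ _≡_ (λ i → vs w (inject₁ i))

Connected : ∀ {n} (G : Graph n) → EdgeSet G → Set
Connected {n} G F = ∀ (u v : Fin n) → Walk G F u v

SpanningTree : ∀ {n} (G : Graph n) → EdgeSet G → Set
SpanningTree {n} G F = (1 ≤ n) × Connected G F × ¬ HasCycle G F

-- the spanning subgraph (V(G), F) is a map-graph: it has an orientation
-- (tail e is one endpoint of e, the head being the other) in which
-- every vertex has out-degree exactly one
MapGraph : ∀ {n} (G : Graph n) → EdgeSet G → Set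
MapGraph {n} G F = Σ (Fin (m G) → Fin n) λ tail →
  (∀ e → F e → tail e ≡ proj₁ (ends G e) ⊎ tail e ≡ proj₂ (ends G e)) ×
  (∀ v → Σ (Fin (m G)) λ e → F e × tail e ≡ v ×
           (∀ e′ → F e′ → tail e′ ≡ v → e′ ≡ e))

MapsAndTrees : ℕ → ℕ → ∀ {n} → Graph n → Set
MapsAndTrees k ℓ G = Σ (Fin (m G) → Fin k) λ col →
  (∀ (i : Fin k) → toℕ i < ℓ → SpanningTree G (λ e → col e ≡ i)) ×
  (∀ (i : Fin k) → ℓ ≤ toℕ i → MapGraph G (λ e → col e ≡ i))

-- The (k,ℓ)-pebble game with colors on the vertex set Fin n.
-- A state: the directed multigraph H as a list of edges (tail , head ,
-- colour of the pebble on that edge), and peb v c = number of pebbles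
-- of colour c lying on vertex v.

record PState (n k : ℕ) : Set where
  constructor ⟨_,_⟩
  field
    H   : List (Fin n × Fin n × Fin k)
    peb : Fin n → Fin k → ℕ
open PState public

pebTotal : ∀ {n k} → (Fin n → Fin k → ℕ) → Fin n → ℕ
pebTotal {k = zero}  P v = 0
pebTotal {k = suc k} P v = P v zero + pebTotal (λ x c → P x (suc c)) v

δ : ∀ {n k} → Fin n → Fin k → Fin n → Fin k → ℕ
δ v c x d = if ⌊ x ≟ v ⌋ ∧ ⌊ d ≟ c ⌋ then 1 else 0

pebOnSet : ∀ {n k} → (Fin n → Fin k → ℕ) → Fin n → Fin n → ℕ
pebOnSet P v w = if ⌊ v ≟ w ⌋ then pebTotal P v else pebTotal P v + pebTotal P w

initial : ∀ n k → PState n k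
initial n k = ⟨ [] , (λ _ _ → 1) ⟩

data Move {n k : ℕ} (ℓ : ℕ) : PState n k → PState n k → Set where
  add-edge : ∀ {H P P′} (v w : Fin n) (c : Fin k) →
    1 ≤ P v c →
    suc ℓ ≤ pebOnSet P v w →
    (∀ x d → P′ x d + δ v c x d ≡ P x d) →
    Move ℓ ⟨ H , P ⟩ ⟨ (v , w , c) ∷ H , P′ ⟩
  pebble-slide : ∀ {H P P′} (i : Fin (length H)) (v w : Fin n) (c c′ : Fin k) →
    lookup H i ≡ (v , w , c) →
    1 ≤ P w c′ →
    (∀ x d → P′ x d + δ w c′ x d ≡ P x d + δ v c x d) →
    Move ℓ ⟨ H , P ⟩ ⟨ H [ i ]∷= (w , v , c′) , P′ ⟩

Underlying : ∀ {n k} → Graph n → List (Fin n × Fin n × Fin k) → Set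
Underlying G H = Σ (Fin (m G) ↔ Fin (length H)) λ σ →
  ∀ e → Joins G e (proj₁ (lookup H (Inverse.to σ e)))
                  (proj₁ (proj₂ (lookup H (Inverse.to σ e))))

PebbleGameGraph : ℕ → ℕ → ∀ {n} → Graph n → Set
PebbleGameGraph k ℓ {n} G = Σ (PState n k) λ s →
  Star (Move ℓ) (initial n k) s × Underlying G (H s)

{-# OPTIONS --safe #-}
module Submission where

-- Maps-and-trees are tight because both kinds of classes inject into their vertices: in a map-graph every
-- edge goes to its tail, and in a tree rooted somewhere every edge goes to its lower end, which misses the
-- vertex of a given set that is closest to the root.
--
-- A sparse graph can be built by the game one edge vw at a time: let S be the set of vertices reachable from
-- {v,w} along arcs.  No arc leaves S, so S carries k|S| minus its number of edges, i.e. at least ℓ+1 pebbles,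
-- and a pebble of S outside {v,w} can be moved to {v,w} by reversing a path.
--
-- If the graph is tight, the same argument gathers all ℓ remaining pebbles on one vertex r.  Then every vertex
-- other than r has out-degree k, r has out-degree k-ℓ, and sparsity says that at least ℓ arcs leave every
-- nonempty set avoiding r.  By Edmonds' theorem there are ℓ disjoint spanning trees directed towards r; the
-- remaining arcs have out-degree k-ℓ everywhere and split into k-ℓ map-graphs.

open import Defs
open import Data.Nat using (ℕ; zero; suc; _+_; _*_; _∸_; _≤_; _<_; z≤n; s≤s; _<?_; _≤?_)
open import Data.Nat.Properties hiding (_≟_; suc-injective)
import Data.Nat.ListAction as ListAction
open import Data.Nat.Induction using (<-wellFounded)
open import Data.Nat.Solver using (module +-*-Solver)
open import Induction.WellFounded using (Acc; acc)
open import Algebra.Properties.Semiring.Sum +-*-semiring as Sum using (sum)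
open import Data.Fin using (Fin; zero; suc; toℕ; _≟_; fromℕ; inject₁; fromℕ<; cast)
open import Data.Fin.Properties using (any?; suc-injective; inject₁-injective; fromℕ≢inject₁; toℕ-inject₁; toℕ-fromℕ<; toℕ-injective; toℕ<n; cast-involutive)
open import Data.Fin.Subset using (Subset; _∈_; ∣_∣)
open import Data.Fin.Subset.Properties using (anySubset?)
open import Data.Vec using ([]; _∷_; lookup; tabulate)
open import Data.Vec.Properties using ([]=⇒lookup; lookup⇒[]=; lookup∘tabulate)
open import Data.List using (List; []; _∷_)
import Data.List as List
open import Data.List.Base using (_[_]∷=_)
open import Data.List.Membership.Propositional using (find) renaming (_∈_ to _∈ₗ_)
open import Data.List.Relation.Unary.Any as Any using (here; there)
open import Data.List.Relation.Unary.Any.Properties using (lookup-index)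
open import Data.List.Relation.Unary.All as All using (All; []; _∷_)
open import Data.List.Relation.Binary.Pointwise using (Pointwise; []; _∷_)
open import Data.Bool using (Bool; true; false; _∧_; _∨_; not; if_then_else_)
import Data.Bool as Bool
open import Data.Bool.Properties using (∨-comm; ∧-comm; ∨-idem; ∧-zeroʳ; ¬-not)
open import Data.Product using (Σ; _×_; _,_; ∃; proj₁; proj₂)
open import Data.Sum using (_⊎_; inj₁; inj₂)
open import Data.Unit using (⊤; tt)
open import Function using (_∘_; mk⇔; mk↔ₛ′)
open import Function.Bundles using (_⇔_)
open import Function.Definitions using (Injective)
open import Relation.Nullary using (¬_; Dec; yes; no; does; contradiction; _×-dec_)
open import Relation.Nullary.Decidable using (dec-true; dec-false; isYes≗does)
open import Relation.Binary.PropositionalEquality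
open import Relation.Binary.Construct.Closure.ReflexiveTransitive using (Star; ε; _◅_; _◅◅_; reverse)

-- Counting

-- The link between the game and the decomposition is the balance "pebbles plus out-degree equals
-- `k`", which every move preserves at every vertex. Sparsity compares the edges inside S with k|S|:
-- if no arc leaves S, the difference shows up as pebbles on S; if S carries no pebbles, it shows up
-- as at least ℓ arcs leaving S. The obstacle in the decomposition is that trees cannot be peeled
-- off arbitrarily: after each one, every nonempty set avoiding `r` must keep enough leaving arcs
-- for the trees still to come. Submodularity of the cut function is what makes a safe choice of
-- each arc possible. Maps need no such care, since one arc out of each vertex is always a
-- map-graph. Connectedness and acyclicity are statements about walks and are awkward both to count
-- with and to extend. All trees are therefore handled as in-trees: each vertex except the root has
-- exactly one arc out of it, and a rank drops along every arc. Walks occur only in the translation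
-- between the two notions.

χ : Bool → ℕ
χ true  = 1
χ false = 0

infix 5 _==_
_==_ : ∀ {n} → Fin n → Fin n → Bool
x == y = does (x ≟ y)

==-refl : ∀ {n} (x : Fin n) → (x == x) ≡ true
==-refl x = dec-true (x ≟ x) refl

==⇒≡ : ∀ {n} {x y : Fin n} → (x == y) ≡ true → x ≡ y
==⇒≡ {x = x} {y} eq with x ≟ y
... | yes p = p

≢⇒== : ∀ {n} {x y : Fin n} → x ≢ y → (x == y) ≡ false
≢⇒== {x = x} {y} = dec-false (x ≟ y)

true≢false : ∀ {b} → b ≡ true → b ≢ false
true≢false refl ()

∧-intro : ∀ {a b} → a ≡ true → b ≡ true → a ∧ b ≡ true
∧-intro refl refl = refl

∧-elim : ∀ a {b} → a ∧ b ≡ true → a ≡ true × b ≡ true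
∧-elim true eq = refl , eq

∨-elim : ∀ a {b} → a ∨ b ≡ true → a ≡ true ⊎ b ≡ true
∨-elim true  _  = inj₁ refl
∨-elim false eq = inj₂ eq

∨-introˡ : ∀ {a b} → a ≡ true → a ∨ b ≡ true
∨-introˡ refl = refl

∨-introʳ : ∀ a {b} → b ≡ true → a ∨ b ≡ true
∨-introʳ true  eq = refl
∨-introʳ false eq = eq

not-elim : ∀ {a} → not a ≡ true → a ≡ false
not-elim {false} _ = refl

χ-∧ : ∀ a b → χ (a ∧ b) ≡ χ a * χ b
χ-∧ true  b = sym (+-identityʳ (χ b))
χ-∧ false b = refl

χ-mono : ∀ {a b} → (a ≡ true → b ≡ true) → χ a ≤ χ b
χ-mono {false}         imp = z≤n
χ-mono {true}  {true}  imp = ≤-refl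
χ-mono {true}  {false} imp = contradiction (imp refl) λ ()

χ-positive : ∀ {b} → 1 ≤ χ b → b ≡ true
χ-positive {true} _ = refl

-- The library sum is sealed because unfolding it blocks the inference of its argument.
opaque
  ∑ : ∀ {n} → (Fin n → ℕ) → ℕ
  ∑ = sum

  ∑-empty : (f : Fin 0 → ℕ) → ∑ f ≡ 0
  ∑-empty f = refl

  ∑-suc : ∀ {n} (f : Fin (suc n) → ℕ) → ∑ f ≡ f zero + ∑ (f ∘ suc)
  ∑-suc f = refl

  ∑-cong : ∀ {n} {f g : Fin n → ℕ} → (∀ i → f i ≡ g i) → ∑ f ≡ ∑ g
  ∑-cong = Sum.sum-cong-≗

  ∑-+ : ∀ {n} (f g : Fin n → ℕ) → ∑ (λ i → f i + g i) ≡ ∑ f + ∑ g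
  ∑-+ = Sum.∑-distrib-+

  ∑-comm : ∀ {m n} (f : Fin m → Fin n → ℕ) → ∑ (λ i → ∑ λ j → f i j) ≡ ∑ (λ j → ∑ λ i → f i j)
  ∑-comm = Sum.∑-comm

  ∑-*ˡ : ∀ {n} c (f : Fin n → ℕ) → c * ∑ f ≡ ∑ (λ i → c * f i)
  ∑-*ˡ = Sum.*-distribˡ-sum

  ∑-mono : ∀ {n} {f g : Fin n → ℕ} → (∀ i → f i ≤ g i) → ∑ f ≤ ∑ g
  ∑-mono {zero}  f≤g = z≤n
  ∑-mono {suc n} f≤g = +-mono-≤ (f≤g zero) (∑-mono (f≤g ∘ suc))

  ∑-const : ∀ n c → ∑ {n} (λ _ → c) ≡ n * c
  ∑-const zero    c = refl
  ∑-const (suc n) c = cong (c +_) (∑-const n c)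

∑-zero : ∀ {n} (f : Fin n → ℕ) → (∀ i → f i ≡ 0) → ∑ f ≡ 0
∑-zero {n} f f≡0 = trans (∑-cong f≡0) (trans (∑-const n 0) (*-zeroʳ n))

opaque
  unfolding ∑

  -- The source of most witnesses: a colour, a pebble or an arc is found by comparing two sums.
  ∑-<⇒∃< : ∀ {n} (f g : Fin n → ℕ) → ∑ f < ∑ g → ∃ λ i → f i < g i
  ∑-<⇒∃< {suc n} f g lt with f zero <? g zero
  ... | yes p = zero , p
  ... | no ¬p with ∑-<⇒∃< (f ∘ suc) (g ∘ suc)
                     (≰⇒> λ le → <⇒≱ lt (+-mono-≤ (≮⇒≥ ¬p) le))
  ...   | i , q = suc i , q

  ∑-δ : ∀ {n} (f : Fin n → ℕ) x → ∑ (λ y → f y * χ (y == x)) ≡ f x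
  ∑-δ f zero = trans (cong₂ _+_ (*-identityʳ (f zero)) (∑-zero _ λ i → *-zeroʳ (f (suc i)))) (+-identityʳ _)
  ∑-δ f (suc x) = cong₂ _+_ (*-zeroʳ (f zero)) (∑-δ (f ∘ suc) x)

card : ∀ {n} → (Fin n → Bool) → ℕ
card b = ∑ (χ ∘ b)

card-mono : ∀ {n} (a b : Fin n → Bool) → (∀ i → a i ≡ true → b i ≡ true) → card a ≤ card b
card-mono a b imp = ∑-mono (χ-mono ∘ imp)

card-positive⇒∃ : ∀ {n} (b : Fin n → Bool) → 1 ≤ card b → ∃ λ i → b i ≡ true
card-positive⇒∃ {n} b pos
  with i , lt ← ∑-<⇒∃< (λ _ → 0) (χ ∘ b) (subst (_< card b) (sym (∑-zero {n} _ λ _ → refl)) pos)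
  = i , χ-positive lt

card-singleton : ∀ {n} (x : Fin n) → card (_== x) ≡ 1
card-singleton x = trans (∑-cong λ y → sym (*-identityˡ (χ (y == x)))) (∑-δ (λ _ → 1) x)

card-∃! : ∀ {n} {b : Fin n → Bool} x → b x ≡ true → (∀ y → b y ≡ true → y ≡ x) → card b ≡ 1
card-∃! {b = b} x bx unique = ≤-antisym
  (≤-trans (card-mono b (_== x) λ y by → subst (λ z → (z == x) ≡ true) (sym (unique y by)) (==-refl x)) (≤-reflexive (card-singleton x)))
  (≤-trans (≤-reflexive (sym (card-singleton x))) (card-mono (_== x) b λ y eq → subst (λ z → b z ≡ true) (sym (==⇒≡ eq)) bx))

card-∅ : ∀ {n} {b : Fin n → Bool} → (∀ y → b y ≢ true) → card b ≡ 0
card-∅ {b = b} empty = ∑-zero _ λ y → lemma (empty y)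
  where
  lemma : ∀ {a} → a ≢ true → χ a ≡ 0
  lemma {true}  ne = contradiction refl ne
  lemma {false} ne = refl

∃⇒card-positive : ∀ {n} (b : Fin n → Bool) x → b x ≡ true → 1 ≤ card b
∃⇒card-positive b x bx = ≤-trans (≤-reflexive (sym (card-singleton x)))
  (card-mono (_== x) b λ y eq → subst (λ z → b z ≡ true) (sym (==⇒≡ eq)) bx)

card-full : ∀ n → card {n} (λ _ → true) ≡ n
card-full n = trans (∑-const n 1) (*-identityʳ n)

card-delete : ∀ {n} (b : Fin n → Bool) x → b x ≡ true → card (λ y → b y ∧ not (y == x)) + 1 ≡ card b
card-delete b x bx = begin
  card (λ y → b y ∧ not (y == x)) + 1                      ≡⟨ cong (card (λ y → b y ∧ not (y == x)) +_) (card-singleton x) ⟨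
  card (λ y → b y ∧ not (y == x)) + card (_== x)           ≡⟨ ∑-+ (λ y → χ (b y ∧ not (y == x))) (λ y → χ (y == x)) ⟨
  ∑ (λ y → χ (b y ∧ not (y == x)) + χ (y == x))          ≡⟨ ∑-cong pointwise ⟩
  card b                                                   ∎
  where
  open ≡-Reasoning
  pointwise : ∀ y → χ (b y ∧ not (y == x)) + χ (y == x) ≡ χ (b y)
  pointwise y with y ≟ x
  ... | yes refl rewrite bx = refl
  ... | no  _ with b y
  ...   | true  = refl
  ...   | false = refl

card-strict : ∀ {n} (a b : Fin n → Bool) x → (∀ i → a i ≡ true → b i ≡ true) →
              a x ≡ false → b x ≡ true → card a < card b
card-strict a b x a⊆b x∉a x∈b = begin-strict
  card a                                 ≤⟨ card-mono a (λ y → b y ∧ not (y == x)) into ⟩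
  card (λ y → b y ∧ not (y == x))        <⟨ m<m+n _ (s≤s z≤n) ⟩
  card (λ y → b y ∧ not (y == x)) + 1    ≡⟨ card-delete b x x∈b ⟩
  card b                                 ∎
  where
  open ≤-Reasoning
  into : ∀ y → a y ≡ true → b y ∧ not (y == x) ≡ true
  into y y∈ = ∧-intro (a⊆b y y∈) (cong not (≢⇒== {x = y} {x} λ { refl → true≢false y∈ x∉a }))

add : ∀ {n} → (Fin n → Bool) → Fin n → Fin n → Bool
add T x y = T y ∨ (y == x)

card-complement-add : ∀ {n} (T : Fin n → Bool) x → T x ≡ false → card (not ∘ add T x) < card (not ∘ T)
card-complement-add T x x∉ = card-strict (not ∘ add T x) (not ∘ T) x (λ y → weaken (T y))
  (cong not (∨-introʳ (T x) (==-refl x))) (cong not x∉)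
  where
  weaken : ∀ a {b} → not (a ∨ b) ≡ true → not a ≡ true
  weaken false _ = refl

-- Double counting. With `f` a colouring it counts edges by class, with `f` the tail map by
-- out-degree.
card-fibres : ∀ {m n} (X : Fin m → Bool) (f : Fin m → Fin n) → card X ≡ ∑ (λ v → card λ e → X e ∧ (v == f e))
card-fibres X f = begin
  card X                                    ≡⟨ ∑-cong (λ e → sym (∑-δ (λ _ → χ (X e)) (f e))) ⟩
  ∑ (λ e → ∑ λ v → χ (X e) * χ (v == f e))  ≡⟨ ∑-comm (λ e v → χ (X e) * χ (v == f e)) ⟩
  ∑ (λ v → ∑ λ e → χ (X e) * χ (v == f e))  ≡⟨ (∑-cong λ v → ∑-cong λ e → sym (χ-∧ (X e) (v == f e))) ⟩
  ∑ (λ v → card λ e → X e ∧ (v == f e))     ∎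
  where open ≡-Reasoning

card-injection : ∀ {m n} (X : Fin m → Bool) (Y : Fin n → Bool) (f : Fin m → Fin n) →
  (∀ e → X e ≡ true → Y (f e) ≡ true) →
  (∀ e e′ → X e ≡ true → X e′ ≡ true → f e ≡ f e′ → e ≡ e′) →
  card X ≤ card Y
card-injection X Y f into inj = ≤-trans (≤-reflexive (card-fibres X f)) (∑-mono fibre)
  where
  fibre : ∀ v → card (λ e → X e ∧ (v == f e)) ≤ χ (Y v)
  fibre v with any? (λ e → (X e ∧ (v == f e)) Bool.≟ true)
  ... | no none = ≤-trans (≤-reflexive (card-∅ λ e p → none (e , p))) z≤n
  ... | yes (e , p) with Xe , eq ← ∧-elim (X e) p with refl ← ==⇒≡ {x = v} eq = ≤-reflexive (trans
        (card-∃! e p λ e′ p′ → inj e′ e (proj₁ (∧-elim (X e′) p′)) Xe (sym (==⇒≡ (proj₂ (∧-elim (X e′) p′)))))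
        (sym (cong χ (into e Xe))))

card-surjection : ∀ {m n} (X : Fin m → Bool) (Y : Fin n → Bool) (f : Fin m → Fin n) →
  (∀ v → Y v ≡ true → ∃ λ e → X e ≡ true × f e ≡ v) →
  card Y ≤ card X
card-surjection X Y f onto = ≤-trans (∑-mono fibre) (≤-reflexive (sym (card-fibres X f)))
  where
  fibre : ∀ v → χ (Y v) ≤ card (λ e → X e ∧ (v == f e))
  fibre v with Y v in eq
  ... | false = z≤n
  ... | true with e , Xe , refl ← onto v eq = ∃⇒card-positive _ e (∧-intro Xe (==-refl (f e)))

-- Rooted trees

-- A partial tree with vertex set `T` and arc set `F`; `source` and `target` matter on `F` only. The
-- falling `rank` stands in for acyclicity. `Arc` is a parameter so that the same record covers
-- undirected edges, edges of a given class, and arcs with a fixed direction.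
record InTree {n m : ℕ} (Arc : Fin m → Fin n → Fin n → Set) (r : Fin n)
              (T : Fin n → Bool) (F : Fin m → Bool) : Set where
  field
    source target : Fin m → Fin n
    rank          : Fin n → ℕ
    root∈         : T r ≡ true
    arc           : ∀ e → F e ≡ true → Arc e (source e) (target e)
    source∈       : ∀ e → F e ≡ true → T (source e) ≡ true
    target∈       : ∀ e → F e ≡ true → T (target e) ≡ true
    source≢root   : ∀ e → F e ≡ true → source e ≢ r
    descends      : ∀ e → F e ≡ true → rank (target e) < rank (source e)
    unique        : ∀ e e′ → F e ≡ true → F e′ ≡ true → source e ≡ source e′ → e ≡ e′
    leaves        : ∀ v → T v ≡ true → v ≢ r → ∃ λ e → F e ≡ true × source e ≡ v

_[_]≔_ : ∀ {n} {A : Set} → (Fin n → A) → Fin n → A → Fin n → A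
(f [ x ]≔ a) y = if y == x then a else f y

≔-same : ∀ {n} {A : Set} (f : Fin n → A) x a → (f [ x ]≔ a) x ≡ a
≔-same f x a rewrite ==-refl x = refl

≔-other : ∀ {n} {A : Set} (f : Fin n → A) {x} a {y} → y ≢ x → (f [ x ]≔ a) y ≡ f y
≔-other f a y≢x rewrite ≢⇒== y≢x = refl

module _ {n m : ℕ} {Arc : Fin m → Fin n → Fin n → Set} {r : Fin n} where

  rootOnly : InTree Arc r (_== r) (λ _ → false)
  rootOnly = record
    { source = λ _ → r ; target = λ _ → r ; rank = λ _ → 0 ; root∈ = ==-refl r
    ; arc = λ _ () ; source∈ = λ _ () ; target∈ = λ _ () ; source≢root = λ _ () ; descends = λ _ ()
    ; unique = λ _ _ () ; leaves = λ v eq v≢r → contradiction (==⇒≡ eq) v≢r }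

  extend : ∀ {T F} → InTree Arc r T F → ∀ {e x y} → T x ≡ false → T y ≡ true → F e ≡ false → Arc e x y →
           InTree Arc r (add T x) (add F e)
  extend {T} {F} tree {e₀} {x} {y} x∉ y∈ e∉ a = record
    { source = source′
    ; target = target′
    ; rank = rank′
    ; root∈ = ∨-introˡ root∈
    ; arc = λ e → cases e Arc (arc e) a
    ; source∈ = λ e → cases e (λ _ s t → add T x s ≡ true) (λ p → ∨-introˡ (source∈ e p)) (∨-introʳ (T x) (==-refl x))
    ; target∈ = λ e → cases e (λ _ s t → add T x t ≡ true) (λ p → ∨-introˡ (target∈ e p)) (∨-introˡ y∈)
    ; source≢root = λ e → cases e (λ _ s t → s ≢ r) (source≢root e) (λ { refl → true≢false root∈ x∉ })
    ; descends = λ e → cases e (λ _ s t → rank′ t < rank′ s)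
        (λ p → subst₂ _<_ (sym (old (target∈ e p))) (sym (old (source∈ e p))) (descends e p))
        (subst₂ _<_ (sym (old y∈)) (sym (≔-same rank x (suc (rank y)))) ≤-refl)
    ; unique = unique′
    ; leaves = leaves′
    }
    where
    open InTree tree
    source′ = source [ e₀ ]≔ x
    target′ = target [ e₀ ]≔ y
    rank′   = rank [ x ]≔ suc (rank y)

    ∈⇒≢x : ∀ {v} → T v ≡ true → v ≢ x
    ∈⇒≢x v∈ refl = true≢false v∈ x∉

    ∈⇒≢e₀ : ∀ {e} → F e ≡ true → e ≢ e₀
    ∈⇒≢e₀ e∈ refl = true≢false e∈ e∉

    old : ∀ {v} → T v ≡ true → rank′ v ≡ rank v
    old v∈ = ≔-other rank (suc (rank y)) (∈⇒≢x v∈)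

    -- The motive sees an edge together with both its ends, so each field of the larger tree follows
    -- from its old instance and its instance at the new arc.
    cases : ∀ e (P : Fin m → Fin n → Fin n → Set) → (F e ≡ true → P e (source e) (target e)) → P e₀ x y →
            add F e₀ e ≡ true → P e (source′ e) (target′ e)
    cases e P before now e∈ with e ≟ e₀ | ∨-elim (F e) e∈
    ... | yes refl | _      = now
    ... | no  _    | inj₁ p = before p

    unique′ : ∀ e e′ → add F e₀ e ≡ true → add F e₀ e′ ≡ true → source′ e ≡ source′ e′ → e ≡ e′
    unique′ e e′ p p′ eq with e ≟ e₀ | e′ ≟ e₀ | ∨-elim (F e) p | ∨-elim (F e′) p′
    ... | yes refl | yes refl | _ | _ = refl
    ... | yes refl | no _ | _ | inj₁ q′ = contradiction (sym eq) (∈⇒≢x (source∈ e′ q′))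
    ... | no _ | yes refl | inj₁ q | _ = contradiction eq (∈⇒≢x (source∈ e q))
    ... | no _ | no _ | inj₁ q | inj₁ q′ = unique e e′ q q′ eq

    leaves′ : ∀ v → add T x v ≡ true → v ≢ r → ∃ λ e → add F e₀ e ≡ true × source′ e ≡ v
    leaves′ v v∈ v≢r with ∨-elim (T v) v∈
    ... | inj₂ eq with refl ← ==⇒≡ {x = v} eq = e₀ , ∨-introʳ (F e₀) (==-refl e₀) , ≔-same source e₀ x
    ... | inj₁ p with e , q , eq ← leaves v p v≢r =
          e , ∨-introˡ q , trans (≔-other source x (∈⇒≢e₀ q)) eq

  -- Greedy growth from the root alone. The invariant `Q` lets one loop serve twice: it is trivial
  -- when a tree is grown in a connected graph, and it is the connectivity of the remaining arcs in
  -- Edmonds' theorem. The fuel bounds the number of vertices still outside `T`.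
  grow : (Q : (Fin n → Bool) → (Fin m → Bool) → Set) → Q (_== r) (λ _ → false) →
    (∀ T F → InTree Arc r T F → Q T F → (∃ λ x → T x ≡ false) →
      ∃ λ e → ∃ λ x → ∃ λ y → T x ≡ false × T y ≡ true × F e ≡ false × Arc e x y × Q (add T x) (add F e)) →
    ∃ λ T → ∃ λ F → InTree Arc r T F × Q T F × (∀ v → T v ≡ true)
  grow Q q₀ step = loop n (_== r) (λ _ → false) (≤-trans (card-mono _ (λ _ → true) λ _ _ → refl) (≤-reflexive (card-full n))) rootOnly q₀
    where
    loop : ∀ fuel T F → card (not ∘ T) ≤ fuel → InTree Arc r T F → Q T F →
           ∃ λ T → ∃ λ F → InTree Arc r T F × Q T F × (∀ v → T v ≡ true)
    loop fuel T F bound tree q with any? (λ x → T x Bool.≟ false)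
    ... | no none = T , F , tree , q , λ v → ¬-not λ v∉ → none (v , v∉)
    loop zero T F bound tree q | yes (x , x∉) =
      contradiction (≤-trans (∃⇒card-positive (not ∘ T) x (cong not x∉)) bound) λ ()
    loop (suc fuel) T F bound tree q | yes p
      with e , x , y , x∉ , y∈ , e∉ , a , q′ ← step T F tree q p =
      loop fuel (add T x) (add F e) (≤-pred (≤-trans (card-complement-add T x x∉) bound)) (extend tree x∉ y∈ e∉ a) q′

-- Walks, cycles and their absence in in-trees

module _ {n : ℕ} {G : Graph n} where

  Joins-sym : ∀ {e a b} → Joins G e a b → Joins G e b a
  Joins-sym (inj₁ p) = inj₂ p
  Joins-sym (inj₂ p) = inj₁ p

  Joins-unique : ∀ {e a b c d} → Joins G e a b → Joins G e c d → (a ≡ c × b ≡ d) ⊎ (a ≡ d × b ≡ c)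
  Joins-unique (inj₁ p) (inj₁ q) with refl ← trans (sym p) q = inj₁ (refl , refl)
  Joins-unique (inj₁ p) (inj₂ q) with refl ← trans (sym p) q = inj₂ (refl , refl)
  Joins-unique (inj₂ p) (inj₁ q) with refl ← trans (sym p) q = inj₂ (refl , refl)
  Joins-unique (inj₂ p) (inj₂ q) with refl ← trans (sym p) q = inj₁ (refl , refl)

  Adjacent : EdgeSet G → Fin n → Fin n → Set
  Adjacent F u v = ∃ λ e → F e × Joins G e u v

  emptyWalk : ∀ {F u} → Walk G F u u
  emptyWalk {u = u} = record
    { len = 0 ; vs = λ _ → u ; es = λ () ; start = refl ; end = refl ; inF = λ () ; joins = λ () }

  consWalk : ∀ {F u v w} → Adjacent F u v → Walk G F v w → Walk G F u w
  consWalk {F} {u} (e , e∈ , j) W = record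
    { len = suc (len W)
    ; vs = λ { zero → u ; (suc i) → vs W i }
    ; es = λ { zero → e ; (suc i) → es W i }
    ; start = refl
    ; end = end W
    ; inF = λ { zero → e∈ ; (suc i) → inF W i }
    ; joins = λ { zero → subst (Joins G e u) (sym (start W)) j ; (suc i) → joins W i } }

  fromStar : ∀ {F u v} → Star (Adjacent F) u v → Walk G F u v
  fromStar ε        = emptyWalk
  fromStar (a ◅ as) = consWalk a (fromStar as)

  SimpleWalk : EdgeSet G → Fin n → Fin n → Set
  SimpleWalk F u v = Σ (Walk G F u v) λ W → Injective _≡_ _≡_ (vs W)

  suffix : ∀ {F u v} (W : SimpleWalk F u v) i → SimpleWalk F (vs (proj₁ W) i) v
  suffix (W , inj) zero = record { Walk W ; start = refl } , inj
  suffix (record { len = suc l ; vs = vs ; es = es ; end = end ; inF = inF ; joins = joins } , inj) (suc i) =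
    suffix (record { len = l ; vs = vs ∘ suc ; es = es ∘ suc ; start = refl ; end = end ; inF = inF ∘ suc ; joins = joins ∘ suc }
           , suc-injective ∘ inj) i

  -- Loop erasure, needed because cycles must have distinct vertices: if `u` occurs again on the
  -- simplified rest, the walk restarts from that occurrence.
  simplify : ∀ {F u v} → Star (Adjacent F) u v → SimpleWalk F u v
  simplify ε = emptyWalk , λ { {zero} {zero} _ → refl }
  simplify {F} {u} {w} (a ◅ as) with simplify as
  ... | W , inj with any? (λ i → vs W i ≟ u)
  ...   | yes (i , eq) = subst (λ x → SimpleWalk F x w) eq (suffix (W , inj) i)
  ...   | no fresh = consWalk a W ,
          λ { {zero} {zero} _ → refl
            ; {zero} {suc j} eq → contradiction (j , sym eq) fresh
            ; {suc i} {zero} eq → contradiction (i , eq) fresh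
            ; {suc i} {suc j} eq → cong suc (inj eq) }

  -- An edge used at places `i` and `j` joins the same two vertices at both. Traversed the same way,
  -- `i` and `j` agree; traversed in opposite ways, each index would be the successor of the other.
  es-injective : ∀ {F u v} (W : Walk G F u v) → Injective _≡_ _≡_ (vs W) → Injective _≡_ _≡_ (es W)
  es-injective W inj {i} {j} eq with Joins-unique (joins W i) (subst (λ e → Joins G e (vs W (inject₁ j)) (vs W (suc j))) (sym eq) (joins W j))
  ... | inj₁ (p , _) = inject₁-injective (inj p)
  ... | inj₂ (p , q) = contradiction (trans (cong suc (lower p)) (lower′ q)) (m+1+n≢m (toℕ j) ∘ subst (_≡ toℕ j) (+-comm 2 (toℕ j)))
    where
    lower : vs W (inject₁ i) ≡ vs W (suc j) → suc (toℕ j) ≡ toℕ i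
    lower p = trans (sym (cong toℕ (inj p))) (toℕ-inject₁ i)
    lower′ : vs W (suc i) ≡ vs W (inject₁ j) → suc (toℕ i) ≡ toℕ j
    lower′ q = trans (cong toℕ (inj q)) (toℕ-inject₁ j)

  -- The edge is run from `b` to `a` and followed by the walk back to `b`. It differs from the edges
  -- of the walk because it lies outside `F`. If it is a loop, the walk has length 0 and the cycle
  -- length 1.
  closeCycle : ∀ {F F′ : EdgeSet G} {a b e} → (∀ {e} → F e → F′ e) → SimpleWalk F a b →
               Joins G e a b → F′ e → ¬ F e → HasCycle G F′
  closeCycle {F} {F′} {a} {b} {e} F⊆F′ (W , inj) j e∈ e∉ =
    b , consWalk (e , e∈ , Joins-sym j) W′ , s≤s z≤n ,
    (λ { {zero} {zero} _ → refl
       ; {zero} {suc i} eq → contradiction (subst F (sym eq) (inF W i)) e∉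
       ; {suc i} {zero} eq → contradiction (subst F eq (inF W i)) e∉
       ; {suc i} {suc j} eq → cong suc (es-injective W inj eq) }) ,
    (λ { {zero} {zero} _ → refl
       ; {zero} {suc i} eq → contradiction (inj (trans (end W) eq)) fromℕ≢inject₁
       ; {suc i} {zero} eq → contradiction (inj (trans (end W) (sym eq))) fromℕ≢inject₁
       ; {suc i} {suc j} eq → cong suc (inject₁-injective (inj eq)) })
    where
    W′ : Walk G F′ a b
    W′ = record { Walk W ; inF = F⊆F′ ∘ inF W }

  crossing : ∀ {F u v} (W : Walk G F u v) (T : Fin n → Bool) → T u ≡ false → T v ≡ true →
             ∃ λ i → T (vs W (inject₁ i)) ≡ false × T (vs W (suc i)) ≡ true
  crossing {F} {u} {v} W T u∉ v∈ =
    go (len W) (T ∘ vs W) (trans (cong T (start W)) u∉) (trans (cong T (end W)) v∈)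
    where
    go : ∀ l (b : Fin (suc l) → Bool) → b zero ≡ false → b (fromℕ l) ≡ true →
         ∃ λ i → b (inject₁ i) ≡ false × b (suc i) ≡ true
    go zero    b p q = contradiction p (true≢false q)
    go (suc l) b p q with b (suc zero) in eq
    ... | true  = zero , p , eq
    ... | false with i , p′ , q′ ← go l (b ∘ suc) eq q = suc i , p′ , q′

  module _ {F : Fin (m G) → Bool} {T : Fin n → Bool} {r : Fin n}
           (tree : InTree (Joins G) r T F) where
    open InTree tree

    toRoot : ∀ v → T v ≡ true → Star (Adjacent (λ e → F e ≡ true)) v r
    toRoot v = go v (<-wellFounded (rank v))
      where
      go : ∀ v → Acc _<_ (rank v) → T v ≡ true → Star (Adjacent (λ e → F e ≡ true)) v r
      go v (acc rec) v∈ with v ≟ r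
      ... | yes refl = ε
      ... | no v≢r with e , e∈ , refl ← leaves v v∈ v≢r =
            (e , e∈ , arc e e∈) ◅ go (target e) (rec (descends e e∈)) (target∈ e e∈)

    connect : ∀ u v → T u ≡ true → T v ≡ true → Star (Adjacent (λ e → F e ≡ true)) u v
    connect u v u∈ v∈ = toRoot u u∈ ◅◅ reverse (λ (e , e∈ , j) → e , e∈ , Joins-sym j) (toRoot v v∈)

    oriented : ∀ {e a b} → F e ≡ true → Joins G e a b →
               (source e ≡ a × rank b < rank a) ⊎ (source e ≡ b × rank a < rank b)
    oriented {e} e∈ j with Joins-unique (arc e e∈) j
    ... | inj₁ (refl , refl) = inj₁ (refl , descends e e∈)
    ... | inj₂ (refl , refl) = inj₂ (refl , descends e e∈)

    -- A walk with distinct edges climbs towards the root, then descends, and never climbs again.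
    Shape : ∀ l → (Fin (suc (suc l)) → Fin n) → (Fin (suc l) → Fin (m G)) → Set
    Shape l vs es =
        (source (es zero) ≡ vs zero × rank (vs (fromℕ (suc l))) < rank (vs zero))
      ⊎ (source (es zero) ≡ vs zero × source (es (fromℕ l)) ≡ vs (fromℕ (suc l)))
      ⊎ (source (es zero) ≡ vs (suc zero) × source (es (fromℕ l)) ≡ vs (fromℕ (suc l)) × rank (vs zero) < rank (vs (fromℕ (suc l))))

    -- A descending edge followed by a climbing one cannot occur: both would have the vertex between
    -- them as source, so by `unique` they would be one edge used twice.
    shape : ∀ l vs es → Injective _≡_ _≡_ es → (∀ i → F (es i) ≡ true) →
            (∀ i → Joins G (es i) (vs (inject₁ i)) (vs (suc i))) → Shape l vs es
    shape zero vs es inj es∈ js with oriented (es∈ zero) (js zero)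
    ... | inj₁ (s , lt) = inj₁ (s , lt)
    ... | inj₂ (s , lt) = inj₂ (inj₂ (s , s , lt))
    shape (suc l) vs es inj es∈ js
      with oriented (es∈ zero) (js zero)
         | shape l (vs ∘ suc) (es ∘ suc) (suc-injective ∘ inj) (es∈ ∘ suc) (js ∘ suc)
    ... | inj₁ (s , lt) | inj₁ (_ , lt′)             = inj₁ (s , <-trans lt′ lt)
    ... | inj₁ (s , lt) | inj₂ (inj₁ (_ , s′))       = inj₂ (inj₁ (s , s′))
    ... | inj₁ (s , lt) | inj₂ (inj₂ (_ , s′ , _))   = inj₂ (inj₁ (s , s′))
    ... | inj₂ (s , lt) | inj₁ (s₁ , _)              =
          contradiction (inj (unique _ _ (es∈ zero) (es∈ (suc zero)) (trans s (sym s₁)))) λ ()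
    ... | inj₂ (s , lt) | inj₂ (inj₁ (s₁ , _))       =
          contradiction (inj (unique _ _ (es∈ zero) (es∈ (suc zero)) (trans s (sym s₁)))) λ ()
    ... | inj₂ (s , lt) | inj₂ (inj₂ (_ , s′ , lt′)) = inj₂ (inj₂ (s , s′ , <-trans lt lt′))

    -- A closed walk cannot only climb or only descend, since the ranks of its ends agree. If it
    -- climbs at the start and descends at the end, its first and last edges share their source, so
    -- they are the same edge.
    acyclic : ¬ HasCycle G (λ e → F e ≡ true)
    acyclic (v , record { len = suc l ; vs = vs ; es = es ; start = start ; end = end ; inF = inF ; joins = js } , _ , inj , _)
      with shape l vs es inj inF js
    ... | inj₁ (_ , lt) = <-irrefl (cong rank (trans end (sym start))) lt
    ... | inj₂ (inj₂ (_ , _ , lt)) = <-irrefl (cong rank (trans start (sym end))) lt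
    -- With a single edge, first and last coincide legitimately; then the edge is a loop, which the
    -- strict drop of `rank` excludes.
    acyclic (v , record { len = suc zero ; vs = vs ; es = es ; start = start ; end = end ; inF = inF ; joins = js } , _ , inj , _)
        | inj₂ (inj₁ (s , s′)) with oriented (inF zero) (js zero)
    ... | inj₁ (_ , lt) = <-irrefl (cong rank (trans end (sym start))) lt
    ... | inj₂ (_ , lt) = <-irrefl (cong rank (trans start (sym end))) lt
    acyclic (v , record { len = suc (suc l) ; vs = vs ; es = es ; start = start ; end = end ; inF = inF ; joins = js } , _ , inj , _)
        | inj₂ (inj₁ (s , s′)) =
      contradiction (inj (unique _ _ (inF zero) (inF (fromℕ (suc l))) (trans s (trans start (sym (trans s′ end)))))) λ ()

inTree⇒spanningTree : ∀ {n} {G : Graph n} {E : EdgeSet G} {F T r} → InTree (Joins G) r T F → (∀ v → T v ≡ true) →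
  (∀ e → E e → F e ≡ true) → (∀ e → F e ≡ true → E e) → SpanningTree G E
inTree⇒spanningTree {suc n} {G} {E} {F} {T} tree full E⊆F F⊆E =
  s≤s z≤n ,
  (λ u v → let W = fromStar (connect tree u v (full u) (full v)) in record { Walk W ; inF = λ i → F⊆E _ (inF W i) }) ,
  λ (v , W , long , inj , simple) → acyclic tree (v , record { Walk W ; inF = λ i → E⊆F _ (inF W i) } , long , inj , simple)

-- Connectedness lets a tree grow inside `E` until it spans. Nothing of `E` is then left over: a
-- further edge would close a cycle with the tree path between its ends.
spanningTree⇒inTree : ∀ {n} {G : Graph n} (E : Fin (m G) → Bool) r →
  SpanningTree G (λ e → E e ≡ true) → ∃ λ T → InTree (Joins G) r T E × (∀ v → T v ≡ true)
spanningTree⇒inTree {n} {G} E r (_ , connected , noCycle)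
  = let T , F , tree , _ , full = grow {r = r} (λ _ _ → ⊤) tt step in result T F tree full
  where
  open InTree
  step : ∀ T F → InTree (λ e x y → E e ≡ true × Joins G e x y) r T F → ⊤ → (∃ λ x → T x ≡ false) →
      ∃ λ e → ∃ λ x → ∃ λ y → T x ≡ false × T y ≡ true × F e ≡ false × (E e ≡ true × Joins G e x y) × ⊤
  step T F tree _ (x , x∉) with W ← connected x r with i , p , q ← crossing W T x∉ (root∈ tree) =
    es W i , _ , _ , p , q , fresh (F (es W i)) refl , (inF W i , joins W i) , tt
    where
    fresh : ∀ b → F (es W i) ≡ b → b ≡ false
    fresh false _ = refl
    -- A tree edge has both ends in `T`, whereas the crossing edge starts outside `T`.
    fresh true  f with Joins-unique {G = G} (joins W i) (proj₂ (arc tree _ f))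
    ... | inj₁ (eq , _) = contradiction p (true≢false (trans (cong T eq) (source∈ tree _ f)))
    ... | inj₂ (eq , _) = contradiction p (true≢false (trans (cong T eq) (target∈ tree _ f)))

  module _ T F (tree : InTree (λ e x y → E e ≡ true × Joins G e x y) r T F) (full : ∀ v → T v ≡ true) where
    tree′ : InTree (Joins G) r T F
    tree′ = record { InTree tree ; arc = λ e p → proj₂ (arc tree e p) }

    E⊆F : ∀ e → E e ≡ true → F e ≡ true
    E⊆F e e∈ with F e in eq
    ... | true  = refl
    ... | false = contradiction
          (closeCycle (λ p → proj₁ (arc tree _ p)) (simplify (connect tree′ _ _ (full _) (full _))) (inj₁ refl) e∈ (λ p → true≢false p eq))
          noCycle

    result : ∃ λ T → InTree (Joins G) r T E × (∀ v → T v ≡ true)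
    result = T , record
      { InTree tree
      ; arc = λ e p → proj₂ (arc tree e (E⊆F e p))
      ; source∈ = λ e p → full _
      ; target∈ = λ e p → full _
      ; source≢root = λ e p → source≢root tree e (E⊆F e p)
      ; descends = λ e p → descends tree e (E⊆F e p)
      ; unique = λ e e′ p p′ → unique tree e e′ (E⊆F e p) (E⊆F e′ p′)
      ; leaves = λ v v∈ v≢r → let e , p , q = leaves tree v v∈ v≢r in e , proj₁ (arc tree e p) , q
      } , full

-- Maps-and-trees are tight

card-lookup : ∀ {n} (p : Subset n) → ∣ p ∣ ≡ card (lookup p)
card-lookup []          = sym (∑-empty _)
card-lookup (true ∷ p)  = trans (cong suc (card-lookup p)) (sym (∑-suc _))
card-lookup (false ∷ p) = trans (card-lookup p) (sym (∑-suc _))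

card-below : ∀ {k ℓ} → ℓ ≤ k → card {k} (λ i → does (toℕ i <? ℓ)) ≡ ℓ
card-below {k} z≤n = card-∅ {k} λ i ()
card-below {suc k} {suc ℓ} (s≤s ℓ≤k) = trans (∑-suc _) (cong suc (trans (∑-cong pointwise) (card-below ℓ≤k)))
  where
  pointwise : ∀ (i : Fin k) → χ (does (toℕ (suc i) <? suc ℓ)) ≡ χ (does (toℕ i <? ℓ))
  pointwise i with toℕ i <? ℓ | suc (toℕ i) <? suc ℓ
  ... | yes _ | yes _ = refl
  ... | no _  | no _  = refl
  ... | yes p | no ¬p = contradiction (s≤s p) ¬p
  ... | no ¬p | yes (s≤s p) = contradiction p ¬p

argmin : ∀ {n} (S : Fin n → Bool) (h : Fin n → ℕ) x → S x ≡ true →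
         ∃ λ y → S y ≡ true × (∀ z → S z ≡ true → h y ≤ h z)
argmin {n} S h x = go x (<-wellFounded (h x))
  where
  go : ∀ x → Acc _<_ (h x) → S x ≡ true → ∃ λ y → S y ≡ true × (∀ z → S z ≡ true → h y ≤ h z)
  go x (acc rec) x∈ with any? (λ y → (S y Bool.≟ true) ×-dec (h y <? h x))
  ... | yes (y , y∈ , lt) = go y (rec lt) y∈
  ... | no none = x , x∈ , λ z z∈ → ≮⇒≥ λ lt → none (z , z∈ , lt)

module _ {n} {G : Graph n} where

  Inside : (Fin (m G) → Bool) → (Fin n → Bool) → Set
  Inside X S = ∀ e → X e ≡ true → S (proj₁ (ends G e)) ≡ true × S (proj₂ (ends G e)) ≡ true

  joins-inside : ∀ {X S} → Inside X S → ∀ {e a b} → X e ≡ true → Joins G e a b → S a ≡ true × S b ≡ true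
  joins-inside in-S e∈ (inj₁ eq) with in-S _ e∈
  ... | p , q rewrite eq = p , q
  joins-inside in-S e∈ (inj₂ eq) with in-S _ e∈
  ... | p , q rewrite eq = q , p

  module _ {r : Fin n} {T : Fin n → Bool} {E : Fin (m G) → Bool} (tree : InTree (Joins G) r T E) where
    open InTree tree

    inTree-sparse : ∀ X S → (∀ e → X e ≡ true → E e ≡ true) → Inside X S → ∀ x → S x ≡ true → card X + 1 ≤ card S
    inTree-sparse X S X⊆E in-S x x∈ with y , y∈ , minimal ← argmin S rank x x∈ = begin
      card X + 1                              ≤⟨ +-monoˡ-≤ 1 (card-injection X (λ z → S z ∧ not (z == y)) source into
                                                   λ e e′ p p′ → unique e e′ (X⊆E e p) (X⊆E e′ p′)) ⟩
      card (λ z → S z ∧ not (z == y)) + 1     ≡⟨ card-delete S y y∈ ⟩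
      card S                                  ∎
      where
      open ≤-Reasoning
      into : ∀ e → X e ≡ true → S (source e) ∧ not (source e == y) ≡ true
      into e e∈ with s∈ , t∈ ← joins-inside {S = S} in-S e∈ (arc e (X⊆E e e∈)) =
        -- If the source were the minimal vertex `y`, the target would be a vertex of `S` of still
        -- smaller rank.
        ∧-intro s∈ (cong not (≢⇒== λ eq →
          <⇒≱ (subst (λ z → rank (target e) < rank z) eq (descends e (X⊆E e e∈))) (minimal _ t∈)))

    -- The upper bound is sparsity for the whole vertex set; the lower bound holds because every
    -- vertex except `r` is a source.
    inTree-card : (∀ v → T v ≡ true) → card E + 1 ≡ n
    inTree-card full = ≤-antisym
      (≤-trans (inTree-sparse E (λ _ → true) (λ _ p → p) (λ _ _ → refl , refl) r refl) (≤-reflexive (card-full n)))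
      (begin
        n                                 ≡⟨ card-full n ⟨
        card {n} (λ _ → true)             ≡⟨ card-delete (λ _ → true) r refl ⟨
        card (λ v → not (v == r)) + 1     ≤⟨ +-monoˡ-≤ 1 (card-surjection E _ source λ v p → leaves v (full v) (nonroot v p)) ⟩
        card E + 1                        ∎)
      where
      open ≤-Reasoning
      nonroot : ∀ v → not (v == r) ≡ true → v ≢ r
      nonroot v p refl rewrite ==-refl v = contradiction p λ ()

  module _ (E : Fin (m G) → Bool) (mapGraph : MapGraph G (λ e → E e ≡ true)) where
    private
      tail    = proj₁ mapGraph
      isEnd   = proj₁ (proj₂ mapGraph)
      outEdge = proj₂ (proj₂ mapGraph)

    mapGraph-sparse : ∀ X S → (∀ e → X e ≡ true → E e ≡ true) → Inside X S → card X ≤ card S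
    mapGraph-sparse X S X⊆E in-S = card-injection X S tail into inj
      where
      into : ∀ e → X e ≡ true → S (tail e) ≡ true
      into e e∈ with isEnd e (X⊆E e e∈)
      ... | inj₁ eq = trans (cong S eq) (proj₁ (in-S e e∈))
      ... | inj₂ eq = trans (cong S eq) (proj₂ (in-S e e∈))
      inj : ∀ e e′ → X e ≡ true → X e′ ≡ true → tail e ≡ tail e′ → e ≡ e′
      inj e e′ p p′ eq with _ , _ , _ , only ← outEdge (tail e) =
        trans (only e (X⊆E e p) refl) (sym (only e′ (X⊆E e′ p′) (sym eq)))

    mapGraph-card : card E ≡ n
    mapGraph-card = ≤-antisym
      (≤-trans (mapGraph-sparse E (λ _ → true) (λ _ p → p) (λ _ _ → refl , refl)) (≤-reflexive (card-full n)))
      (≤-trans (≤-reflexive (sym (card-full n)))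
        (card-surjection E (λ _ → true) tail λ v _ → let e , e∈ , eq , _ = outEdge v in e , e∈ , eq))

  resp-spanningTree : {E F : EdgeSet G} → (∀ e → E e → F e) → (∀ e → F e → E e) → SpanningTree G E → SpanningTree G F
  resp-spanningTree E⊆F F⊆E (pos , conn , noCycle) =
    pos , (λ u v → let W = conn u v in record { Walk W ; inF = λ i → E⊆F _ (inF W i) }) ,
    λ (v , W , rest) → noCycle (v , record { Walk W ; inF = λ i → F⊆E _ (inF W i) } , rest)

  resp-mapGraph : {E F : EdgeSet G} → (∀ e → E e → F e) → (∀ e → F e → E e) → MapGraph G E → MapGraph G F
  resp-mapGraph E⊆F F⊆E (tail , isEnd , out) =
    tail , (λ e p → isEnd e (F⊆E e p)) ,
    λ v → let e , p , eq , only = out v in e , E⊆F e p , eq , λ e′ p′ → only e′ (F⊆E e′ p′)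

  module _ {k ℓ} (ℓ≤k : ℓ ≤ k) (mt : MapsAndTrees k ℓ G) where
    private
      col = proj₁ mt

      class : Fin k → Fin (m G) → Bool
      class i e = i == col e

      to : ∀ i e → col e ≡ i → class i e ≡ true
      to i e refl = ==-refl i
      from : ∀ i e → class i e ≡ true → col e ≡ i
      from i e eq = sym (==⇒≡ eq)

      tree : ∀ i → toℕ i < ℓ → ∃ λ r → ∃ λ T → InTree (Joins G) r T (class i) × (∀ v → T v ≡ true)
      tree i lt with sp@(pos , _) ← resp-spanningTree (to i) (from i) (proj₁ (proj₂ mt) i lt) =
        root pos , spanningTree⇒inTree (class i) (root pos) sp
        where
        root : ∀ {n} → 1 ≤ n → Fin n
        root (s≤s _) = zero

      maps : ∀ i → ℓ ≤ toℕ i → MapGraph G (λ e → class i e ≡ true)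
      maps i ge = resp-mapGraph (to i) (from i) (proj₂ (proj₂ mt) i ge)

      below : Fin k → ℕ
      below i = χ (does (toℕ i <? ℓ))

    -- The count is done colour by colour: a tree class has at most |S| - 1 edges inside `S` and a
    -- map class at most |S|. The function `below` marks the tree classes, so its sum supplies the
    -- ℓ.
    mapsAndTrees-sparse : Sparse k ℓ G
    mapsAndTrees-sparse S F sub pos = begin
      ∣ F ∣ + ℓ                                                   ≡⟨ cong₂ _+_ (card-lookup F) (sym (card-below ℓ≤k)) ⟩
      card X + card {k} (λ i → does (toℕ i <? ℓ))                 ≡⟨ cong (_+ ∑ below) (card-fibres X col) ⟩
      ∑ (λ i → card (λ e → X e ∧ class i e)) + ∑ below            ≡⟨ ∑-+ (λ i → card (λ e → X e ∧ class i e)) below ⟨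
      ∑ (λ i → card (λ e → X e ∧ class i e) + below i)            ≤⟨ ∑-mono colour ⟩
      ∑ {k} (λ _ → card (lookup S))                               ≡⟨ ∑-const k _ ⟩
      k * card (lookup S)                                         ≡⟨ cong (k *_) (card-lookup S) ⟨
      k * ∣ S ∣                                                   ∎
      where
      open ≤-Reasoning
      X = lookup F
      in-S : Inside X (lookup S)
      in-S e e∈ with p , q ← sub e (lookup⇒[]= e F e∈) = []=⇒lookup p , []=⇒lookup q
      -- The saving of one per tree requires `S` to be nonempty, even for trees with no edge in `S`;
      -- an end of any edge of `F` provides the vertex.
      some = card-positive⇒∃ X (subst (1 ≤_) (card-lookup F) pos)
      colour : ∀ i → card (λ e → X e ∧ class i e) + below i ≤ card (lookup S)
      colour i with toℕ i <? ℓ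
      ... | yes lt rewrite dec-true (toℕ i <? ℓ) lt = let r , T , t , full = tree i lt in
            inTree-sparse t (λ e → X e ∧ class i e) (lookup S) (λ e → proj₂ ∘ ∧-elim (X e))
              (λ e → in-S e ∘ proj₁ ∘ ∧-elim (X e)) _ (proj₁ (in-S _ (proj₂ some)))
      ... | no ge rewrite dec-false (toℕ i <? ℓ) ge = ≤-trans (≤-reflexive (+-identityʳ _))
            (mapGraph-sparse (class i) (maps i (≮⇒≥ ge)) (λ e → X e ∧ class i e) (lookup S) (λ e → proj₂ ∘ ∧-elim (X e))
              (λ e → in-S e ∘ proj₁ ∘ ∧-elim (X e)))

    mapsAndTrees-tight : Tight k ℓ G
    mapsAndTrees-tight = mapsAndTrees-sparse , (begin
      m G + ℓ                                                     ≡⟨ cong₂ _+_ (card-full (m G)) (card-below ℓ≤k) ⟨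
      card {m G} (λ _ → true) + ∑ below                           ≡⟨ cong (_+ ∑ below) (card-fibres (λ _ → true) col) ⟩
      ∑ (λ i → card (class i)) + ∑ below                          ≡⟨ ∑-+ (λ i → card (class i)) below ⟨
      ∑ (λ i → card (class i) + below i)                          ≡⟨ ∑-cong colour ⟩
      ∑ {k} (λ _ → n)                                             ≡⟨ ∑-const k n ⟩
      k * n                                                       ∎)
      where
      open ≡-Reasoning
      colour : ∀ i → card (class i) + below i ≡ n
      colour i with toℕ i <? ℓ
      ... | yes lt rewrite dec-true (toℕ i <? ℓ) lt = let r , T , t , full = tree i lt in inTree-card t full
      ... | no ge rewrite dec-false (toℕ i <? ℓ) ge = trans (+-identityʳ _) (mapGraph-card (class i) (maps i (≮⇒≥ ge)))

-- Disjoint branchings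

infixl 6 _∖_
_∖_ : ∀ {n} → (Fin n → Bool) → (Fin n → Bool) → Fin n → Bool
(A ∖ B) e = A e ∧ not (B e)

module Branching {n m : ℕ} (tl hd : Fin m → Fin n) where

  leaving : (Fin n → Bool) → Fin m → Bool
  leaving U e = U (tl e) ∧ not (U (hd e))

  cut : (Fin m → Bool) → (Fin n → Bool) → ℕ
  cut A U = card (λ e → A e ∧ leaving U e)

  outdeg : (Fin m → Bool) → Fin n → ℕ
  outdeg A v = card (λ e → A e ∧ (v == tl e))

  cut-cong : ∀ A {U U′} → (∀ v → U v ≡ U′ v) → cut A U ≡ cut A U′
  cut-cong A {U} {U′} eq = ∑-cong λ e → cong₂ (λ a b → χ (A e ∧ (a ∧ not b))) (eq (tl e)) (eq (hd e))

  -- Checked arc by arc. The two sides differ exactly by the arcs of `A` that run between `U` minus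
  -- `X` and `X` minus `U`, in either direction.
  cut-submodular : ∀ A U X → cut A (λ v → U v ∧ X v) + cut A (λ v → U v ∨ X v) ≤ cut A U + cut A X
  cut-submodular A U X = begin
    cut A (λ v → U v ∧ X v) + cut A (λ v → U v ∨ X v)  ≡⟨ ∑-+ (χ ∘ λ e → A e ∧ leaving (λ v → U v ∧ X v) e) (χ ∘ λ e → A e ∧ leaving (λ v → U v ∨ X v) e) ⟨
    ∑ (λ e → χ (A e ∧ leaving (λ v → U v ∧ X v) e) + χ (A e ∧ leaving (λ v → U v ∨ X v) e))
                                                       ≤⟨ ∑-mono (λ e → pointwise (A e) (U (tl e)) (X (tl e)) (U (hd e)) (X (hd e))) ⟩
    ∑ (λ e → χ (A e ∧ leaving U e) + χ (A e ∧ leaving X e))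
                                                       ≡⟨ ∑-+ (χ ∘ λ e → A e ∧ leaving U e) (χ ∘ λ e → A e ∧ leaving X e) ⟩
    cut A U + cut A X                                  ∎
    where
    open ≤-Reasoning
    pointwise : ∀ a u x u′ x′ → χ (a ∧ ((u ∧ x) ∧ not (u′ ∧ x′))) + χ (a ∧ ((u ∨ x) ∧ not (u′ ∨ x′)))
                              ≤ χ (a ∧ (u ∧ not u′)) + χ (a ∧ (x ∧ not x′))
    pointwise false _ _ _ _ = z≤n
    pointwise true false false _ _ = z≤n
    pointwise true true  false true  _     = z≤n
    pointwise true true  false false true  = z≤n
    pointwise true true  false false false = ≤-refl
    pointwise true false true  true  _     = z≤n
    pointwise true false true  false true  = z≤n
    pointwise true false true  false false = ≤-refl
    pointwise true true  true  true  true  = ≤-refl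
    pointwise true true  true  true  false = ≤-refl
    pointwise true true  true  false true  = ≤-refl
    pointwise true true  true  false false = ≤-refl

  cut-delete : ∀ A F e₀ U → cut (A ∖ F) U ≤ cut (A ∖ add F e₀) U + χ (leaving U e₀)
  cut-delete A F e₀ U = begin
    cut (A ∖ F) U
      ≤⟨ ∑-mono (λ e → pointwise (A e) (F e) (e == e₀) (leaving U e)) ⟩
    ∑ (λ e → χ ((A ∖ add F e₀) e ∧ leaving U e) + χ (leaving U e) * χ (e == e₀))
      ≡⟨ ∑-+ (λ e → χ ((A ∖ add F e₀) e ∧ leaving U e)) (λ e → χ (leaving U e) * χ (e == e₀)) ⟩
    cut (A ∖ add F e₀) U + ∑ (λ e → χ (leaving U e) * χ (e == e₀))
      ≡⟨ cong (cut (A ∖ add F e₀) U +_) (∑-δ (χ ∘ leaving U) e₀) ⟩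
    cut (A ∖ add F e₀) U + χ (leaving U e₀) ∎
    where
    open ≤-Reasoning
    pointwise : ∀ a f d l → χ ((a ∧ not f) ∧ l) ≤ χ ((a ∧ not (f ∨ d)) ∧ l) + χ l * χ d
    pointwise false f d l = z≤n
    pointwise true true d l = z≤n
    pointwise true false true true = ≤-refl
    pointwise true false true false = z≤n
    pointwise true false false l = m≤m+n _ _

  outdeg-∖ : ∀ A F → (∀ e → F e ≡ true → A e ≡ true) → ∀ v → outdeg A v ≡ outdeg (A ∖ F) v + outdeg F v
  outdeg-∖ A F F⊆A v = trans (∑-cong λ e → pointwise (A e) (F e) (v == tl e) (F⊆A e))
                             (∑-+ (λ e → χ ((A ∖ F) e ∧ (v == tl e))) (λ e → χ (F e ∧ (v == tl e))))
    where
    pointwise : ∀ a f d → (f ≡ true → a ≡ true) → χ (a ∧ d) ≡ χ ((a ∧ not f) ∧ d) + χ (f ∧ d)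
    pointwise true  true  d _   = refl
    pointwise true  false d _   = sym (+-identityʳ _)
    pointwise false false d _   = refl
    pointwise false true  d imp = contradiction (imp refl) λ ()

  module _ (r : Fin n) where

    -- The cut hypothesis of Edmonds' theorem for branchings directed into the root; `x` witnesses
    -- that `U` is nonempty.
    RootConnected : ℕ → (Fin m → Bool) → Set
    RootConnected j A = ∀ U x → U x ≡ true → U r ≡ false → j ≤ cut A U

    ArcOf : (Fin m → Bool) → Fin m → Fin n → Fin n → Set
    ArcOf A e x y = A e ≡ true × tl e ≡ x × hd e ≡ y

    -- Lovász's proof of Edmonds' theorem: an arc entering the partial tree can be chosen
    -- inside an inclusion-minimal critical set not contained in it.
    module _ (j : ℕ) (A : Fin m → Bool) (conn : RootConnected (suc j) A) where

      -- The critical sets that `e` leaves, which forbid spending `e`. When `A ∖ F` is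
      -- `RootConnected j`, the bound on the cut is an equality.
      Blocking : (Fin m → Bool) → Fin m → (Fin n → Bool) → Set
      Blocking F e X = (X (tl e) ≡ true × X (hd e) ≡ false) × X r ≡ false × cut (A ∖ F) X ≤ j

      blocked? : ∀ F e → Dec (∃ λ (X : Subset n) → Blocking F e (lookup X))
      blocked? F e = anySubset? λ X →
        ((lookup X (tl e) Bool.≟ true) ×-dec (lookup X (hd e) Bool.≟ false)) ×-dec
        ((lookup X r Bool.≟ false) ×-dec (cut (A ∖ F) (lookup X) ≤? j))

      -- Removing `e` lowers the cut of `U` only if `e` leaves `U`. In that case `U` is not
      -- critical, so it had at least `suc j` leaving arcs before.
      unblocked : ∀ F e → RootConnected j (A ∖ F) → ¬ (∃ λ (X : Subset n) → Blocking F e (lookup X)) →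
                  RootConnected j (A ∖ add F e)
      unblocked F e connF free U x x∈ r∉ with leaving U e in eq | cut-delete A F e U
      ... | false | le = ≤-trans (connF U x x∈ r∉) (≤-trans le (≤-reflexive (+-identityʳ _)))
      ... | true  | le with t∈ , h∉ ← ∧-elim (U (tl e)) eq =
            ≤-pred (≤-trans (≰⇒> noncritical) (≤-trans le (≤-reflexive (+-comm _ 1))))
            where
            U≗ : ∀ v → lookup (tabulate U) v ≡ U v
            U≗ = lookup∘tabulate U
            noncritical : ¬ (cut (A ∖ F) U ≤ j)
            noncritical le = free (tabulate U , (trans (U≗ (tl e)) t∈ , trans (U≗ (hd e)) (not-elim h∉)) ,
              trans (U≗ r) r∉ , ≤-trans (≤-reflexive (cut-cong (A ∖ F) U≗)) le)

      module _ {T F} (tree : InTree (ArcOf A) r T F) (connF : RootConnected j (A ∖ F)) where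
        open InTree tree

        Entering : Fin m → Set
        Entering e = (A ∖ F) e ≡ true × T (tl e) ≡ false × T (hd e) ≡ true

        -- Arcs of `F` start in `T`, so none of them leaves a set disjoint from `T`.
        cut-outside : ∀ U → (∀ v → U v ≡ true → T v ≡ false) → cut A U ≤ cut (A ∖ F) U
        cut-outside U U∩T=∅ = card-mono _ _ λ e p →
          let e∈ , l = ∧-elim (A e) p
              t∈ , _ = ∧-elim (U (tl e)) l
          in ∧-intro (∧-intro e∈ (cong not (fresh e (U∩T=∅ _ t∈)))) l
          where
          fresh : ∀ e → T (tl e) ≡ false → F e ≡ false
          fresh e t∉ with F e in eq
          ... | false = refl
          ... | true  = contradiction t∉ (true≢false (trans (cong T (proj₁ (proj₂ (arc e eq)))) (source∈ e eq)))

        -- The set `U ∖ T` is nonempty and avoids `r`, so at least `suc j` arcs leave it, none of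
        -- them in `F`. At most `j` arcs of `A ∖ F` leave `U`, so some arc leaves `U ∖ T` without
        -- leaving `U`: its head lies in both `U` and `T`.
        enteringArc : ∀ U x → U x ≡ true → T x ≡ false → cut (A ∖ F) U ≤ j →
                      ∃ λ e → Entering e × U (tl e) ≡ true × U (hd e) ≡ true
        enteringArc U x x∈ x∉T critical = e , result
          where
          W = U ∖ T
          lt : cut (A ∖ F) U < cut (A ∖ F) W
          lt = ≤-trans (s≤s critical) (≤-trans
            (conn W x (∧-intro x∈ (cong not x∉T)) (trans (cong (λ b → U r ∧ not b) root∈) (∧-zeroʳ (U r))))
            (cut-outside W λ v → not-elim ∘ proj₂ ∘ ∧-elim (U v)))
          witness = ∑-<⇒∃< _ _ lt
          e = proj₁ witness
          pointwise : ∀ a u t u′ t′ → χ (a ∧ (u ∧ not u′)) < χ (a ∧ ((u ∧ not t) ∧ not (u′ ∧ not t′))) →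
                      (a ≡ true × t ≡ false × t′ ≡ true) × u ≡ true × u′ ≡ true
          pointwise true true false true true _ = (refl , refl , refl) , refl , refl
          pointwise true true false false _ (s≤s ())
          result = pointwise ((A ∖ F) e) (U (tl e)) (T (tl e)) (U (hd e)) (T (hd e)) (proj₂ witness)

        -- If the arc found inside `U` is blocked by `X`, the search moves to the intersection of
        -- `U` and `X`. This set is critical too: the two cuts sum to at most 2j, and the union,
        -- which is nonempty and avoids `r`, takes at least j of that. It is smaller because the
        -- head of the arc is in `U` but not in `X`, and it still meets the outside of `T` at the
        -- tail.
        search : ∀ U → Acc _<_ (card U) → ∀ x → U x ≡ true → T x ≡ false → U r ≡ false → cut (A ∖ F) U ≤ j →
                 ∃ λ e → Entering e × RootConnected j (A ∖ add F e)
        search U (acc smaller) x x∈ x∉T r∉ critical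
          with e , enter@(_ , t∉T , _) , t∈ , h∈ ← enteringArc U x x∈ x∉T critical
          with blocked? F e
        ... | no free = e , enter , unblocked F e connF free
        ... | yes (X′ , (t∈X , h∉X) , r∉X , criticalX) =
              search (λ v → U v ∧ X v) (smaller shrinks) (tl e) (∧-intro t∈ t∈X) t∉T
                (cong (_∧ X r) r∉) (+-cancelʳ-≤ j _ _ meet)
          where
          X = lookup X′
          open ≤-Reasoning
          shrinks : card (λ v → U v ∧ X v) < card U
          shrinks = card-strict (λ v → U v ∧ X v) U (hd e) (λ v → proj₁ ∘ ∧-elim (U v)) (cong₂ _∧_ h∈ h∉X) h∈
          meet : cut (A ∖ F) (λ v → U v ∧ X v) + j ≤ j + j
          meet = begin
            cut (A ∖ F) (λ v → U v ∧ X v) + j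
              ≤⟨ +-monoʳ-≤ _ (connF (λ v → U v ∨ X v) x (∨-introˡ x∈) (cong₂ _∨_ r∉ r∉X)) ⟩
            cut (A ∖ F) (λ v → U v ∧ X v) + cut (A ∖ F) (λ v → U v ∨ X v)
              ≤⟨ cut-submodular (A ∖ F) U X ⟩
            cut (A ∖ F) U + cut (A ∖ F) X
              ≤⟨ +-mono-≤ critical criticalX ⟩
            j + j ∎

        safeArc : (∃ λ x → T x ≡ false) → ∃ λ e → Entering e × RootConnected j (A ∖ add F e)
        safeArc (x , x∉T)
          -- No arc leaves the whole vertex set, so it passes as critical here. It contains `r` and
          -- cannot start `search`; if the arc found is blocked, the blocking set does.
          with e , enter@(_ , t∉T , _) , _ ← enteringArc (λ _ → true) x refl x∉T
                 (≤-trans (≤-reflexive (card-∅ λ e p → contradiction (proj₂ (∧-elim ((A ∖ F) e) p)) λ ())) z≤n)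
          with blocked? F e
        ... | no free = e , enter , unblocked F e connF free
        ... | yes (X , (t∈X , _) , r∉X , criticalX) =
              search (lookup X) (<-wellFounded _) (tl e) t∈X t∉T r∉X criticalX

      branching : ∃ λ T → ∃ λ F → InTree (ArcOf A) r T F × RootConnected j (A ∖ F) × (∀ v → T v ≡ true)
      branching = grow (λ T F → RootConnected j (A ∖ F))
        -- Before any arc is taken the connectivity is `suc j`; the unit above `j` is what the
        -- branching may use up.
        (λ U x x∈ r∉ → ≤-trans (≤-trans (n≤1+n j) (conn U x x∈ r∉))
          (card-mono _ _ λ e p → let e∈ , l = ∧-elim (A e) p in ∧-intro (∧-intro e∈ refl) l))
        λ T F tree connF out → let e , (e∈ , t∉ , h∈) , conn′ = safeArc tree connF out
                                   a , f = ∧-elim (A e) e∈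
                               in e , tl e , hd e , t∉ , h∈ , not-elim f , (a , refl , refl) , conn′

    branching-outdeg : ∀ {A T F} → InTree (ArcOf A) r T F → (∀ v → T v ≡ true) → ∀ v → outdeg F v ≡ χ (not (v == r))
    branching-outdeg {A} {T} {F} tree full v with v ≟ r
    ... | yes refl = card-∅ λ e p → let f , eq = ∧-elim (F e) p in
          source≢root e f (trans (sym (proj₁ (proj₂ (arc e f)))) (sym (==⇒≡ eq)))
      where open InTree tree
    ... | no v≢r = let e , f , eq = leaves v (full v) v≢r in
          card-∃! e (∧-intro f (trans (cong (v ==_) (trans (proj₁ (proj₂ (arc e f))) eq)) (==-refl v)))
            λ e′ p → let f′ , eq′ = ∧-elim (F e′) p in
              unique e′ e f′ f (trans (sym (proj₁ (proj₂ (arc e′ f′)))) (trans (sym (==⇒≡ eq′)) (sym eq)))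
      where open InTree tree

-- Peeling off spanning trees and map-graphs

record Peeling {m : ℕ} (Good : (Fin m → Bool) → Set) (t : ℕ) (A R : Fin m → Bool) : Set where
  field
    colour : Fin m → ℕ
    R⊆A    : ∀ e → R e ≡ true → A e ≡ true
    bound  : ∀ e → A e ≡ true → R e ≡ false → colour e < t
    class  : ∀ i → i < t → ∃ λ F → Good F
               × (∀ e → F e ≡ true → A e ≡ true × R e ≡ false × colour e ≡ i)
               × (∀ e → A e ≡ true → R e ≡ false → colour e ≡ i → F e ≡ true)

-- The bookkeeping shared by trees and maps. The class taken first receives the largest colour `t`,
-- so the colours from the recursive call, all below `t`, need no shift.
peel : ∀ {m} {Good : (Fin m → Bool) → Set} (Inv : ℕ → (Fin m → Bool) → Set) →
  (∀ t A → Inv (suc t) A → ∃ λ F → (∀ e → F e ≡ true → A e ≡ true) × Good F × Inv t (A ∖ F)) →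
  ∀ t A → Inv t A → ∃ λ R → Peeling Good t A R × Inv 0 R
peel Inv step zero A inv = A , record
  { colour = λ _ → 0 ; R⊆A = λ _ p → p ; bound = λ e p q → contradiction q (true≢false p) ; class = λ _ () } , inv
peel {m} {Good} Inv step (suc t) A inv
  with F₁ , F₁⊆A , good , inv′ ← step t A inv
  with R , rest , inv₀ ← peel {Good = Good} Inv step t (A ∖ F₁) inv′ = R , record
  { colour = colour′
  ; R⊆A = λ e p → proj₁ (∧-elim (A e) (R⊆A e p))
  ; bound = bound′
  ; class = class′
  } , inv₀
  where
  open Peeling rest
  colour′ : Fin m → ℕ
  colour′ e = if F₁ e then t else colour e

  colour-in : ∀ {e} → F₁ e ≡ true → colour′ e ≡ t
  colour-in f rewrite f = refl

  colour-out : ∀ {e} → F₁ e ≡ false → colour′ e ≡ colour e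
  colour-out f rewrite f = refl

  bound′ : ∀ e → A e ≡ true → R e ≡ false → colour′ e < suc t
  bound′ e a r with F₁ e in eq
  ... | true  = ≤-refl
  ... | false = m≤n⇒m≤1+n (bound e (∧-intro a (cong not eq)) r)

  R-avoids : ∀ e → F₁ e ≡ true → R e ≡ false
  R-avoids e f with R e in eq
  ... | false = refl
  ... | true  = contradiction (not-elim (proj₂ (∧-elim (A e) (R⊆A e eq)))) (true≢false f)

  class′ : ∀ i → i < suc t → ∃ λ F → Good F
             × (∀ e → F e ≡ true → A e ≡ true × R e ≡ false × colour′ e ≡ i)
             × (∀ e → A e ≡ true → R e ≡ false → colour′ e ≡ i → F e ≡ true)
  class′ i (s≤s i≤t) with m≤n⇒m<n∨m≡n i≤t
  ... | inj₂ refl = F₁ , good , (λ e f → F₁⊆A e f , R-avoids e f , colour-in f) , back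
    where
    back : ∀ e → A e ≡ true → R e ≡ false → colour′ e ≡ t → F₁ e ≡ true
    back e a r eq with F₁ e in f
    ... | true  = refl
    ... | false = contradiction (bound e (∧-intro a (cong not f)) r) (<-irrefl eq)
  ... | inj₁ i<t with F , good′ , forth , back ← class i i<t = F , good′ , forth′ , back′
    where
    forth′ : ∀ e → F e ≡ true → A e ≡ true × R e ≡ false × colour′ e ≡ i
    forth′ e f with a , r , eq ← forth e f with a′ , f₁ ← ∧-elim (A e) a =
      a′ , r , trans (colour-out (not-elim f₁)) eq
    back′ : ∀ e → A e ≡ true → R e ≡ false → colour′ e ≡ i → F e ≡ true
    back′ e a r eq with F₁ e in f
    ... | true  = contradiction i<t (<-irrefl (sym eq))
    ... | false = back e (∧-intro a (cong not f)) r eq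

module _ {n} (G : Graph n) (tl hd : Fin (m G) → Fin n) (orients : ∀ e → Joins G e (tl e) (hd e)) where
  open Branching tl hd

  -- With `t` trees still to be taken, a vertex needs one arc out for each of them unless it is `r`,
  -- and `q` arcs out for the maps.
  TreeInv : Fin n → ℕ → ℕ → (Fin (m G) → Bool) → Set
  TreeInv r q t A = RootConnected r t A × (∀ v → outdeg A v ≡ q + t * χ (not (v == r)))

  peelTree : ∀ r q t A → TreeInv r q (suc t) A →
    ∃ λ F → (∀ e → F e ≡ true → A e ≡ true) × SpanningTree G (λ e → F e ≡ true) × TreeInv r q t (A ∖ F)
  peelTree r q t A (conn , deg) with T , F , tree , conn′ , full ← branching r t A conn =
    F , F⊆A ,
    inTree⇒spanningTree record { InTree tree ; arc = λ e f → joinsArc e (arc e f) } full (λ _ f → f) (λ _ f → f) ,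
    conn′ , deg′
    where
    open InTree tree
    F⊆A : ∀ e → F e ≡ true → A e ≡ true
    F⊆A e f = proj₁ (arc e f)
    joinsArc : ∀ e {x y} → ArcOf r A e x y → Joins G e x y
    joinsArc e (_ , refl , refl) = orients e
    open ≡-Reasoning
    deg′ : ∀ v → outdeg (A ∖ F) v ≡ q + t * χ (not (v == r))
    deg′ v = +-cancelʳ-≡ (χ (not (v == r))) _ _ (begin
      outdeg (A ∖ F) v + χ (not (v == r))              ≡⟨ cong (outdeg (A ∖ F) v +_) (branching-outdeg r tree full v) ⟨
      outdeg (A ∖ F) v + outdeg F v                    ≡⟨ outdeg-∖ A F F⊆A v ⟨
      outdeg A v                                       ≡⟨ deg v ⟩
      q + (χ (not (v == r)) + t * χ (not (v == r)))    ≡⟨ cong (q +_) (+-comm (χ (not (v == r))) _) ⟩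
      q + (t * χ (not (v == r)) + χ (not (v == r)))    ≡⟨ +-assoc q _ _ ⟨
      q + t * χ (not (v == r)) + χ (not (v == r))      ∎)

  MapInv : ℕ → (Fin (m G) → Bool) → Set
  MapInv q A = ∀ v → outdeg A v ≡ q

  peelMap : ∀ q A → MapInv (suc q) A →
    ∃ λ F → (∀ e → F e ≡ true → A e ≡ true) × MapGraph G (λ e → F e ≡ true) × MapInv q (A ∖ F)
  peelMap q A deg = F , F⊆A , (tl , isEnd , out) , deg′
    where
    someOut : ∀ v → ∃ λ e → A e ∧ (v == tl e) ≡ true
    someOut v = card-positive⇒∃ _ (≤-trans (s≤s z≤n) (≤-reflexive (sym (deg v))))
    pick : Fin n → Fin (m G)
    pick v = proj₁ (someOut v)
    pick∈ : ∀ v → A (pick v) ≡ true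
    pick∈ v = proj₁ (∧-elim (A (pick v)) (proj₂ (someOut v)))
    tl-pick : ∀ v → tl (pick v) ≡ v
    tl-pick v = sym (==⇒≡ (proj₂ (∧-elim (A (pick v)) (proj₂ (someOut v)))))
    F : Fin (m G) → Bool
    -- This is membership in the image of `pick`: since `pick v` has tail `v`, only the arc picked
    -- at the tail of `e` has to be compared.
    F e = e == pick (tl e)
    F-pick : ∀ v → F (pick v) ≡ true
    F-pick v = trans (cong (λ x → pick v == pick x) (tl-pick v)) (==-refl (pick v))
    F⊆A : ∀ e → F e ≡ true → A e ≡ true
    F⊆A e f = subst (λ x → A x ≡ true) (sym (==⇒≡ f)) (pick∈ (tl e))
    only : ∀ v e → F e ≡ true → tl e ≡ v → e ≡ pick v
    only v e f refl = ==⇒≡ f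
    isEnd : ∀ e → F e ≡ true → tl e ≡ proj₁ (ends G e) ⊎ tl e ≡ proj₂ (ends G e)
    isEnd e _ with orients e
    ... | inj₁ eq = inj₁ (cong proj₁ (sym eq))
    ... | inj₂ eq = inj₂ (cong proj₂ (sym eq))
    out : ∀ v → Σ (Fin (m G)) λ e → F e ≡ true × tl e ≡ v × (∀ e′ → F e′ ≡ true → tl e′ ≡ v → e′ ≡ e)
    out v = pick v , F-pick v , tl-pick v , only v
    deg-F : ∀ v → outdeg F v ≡ 1
    deg-F v = card-∃! (pick v) (∧-intro (F-pick v) (trans (cong (v ==_) (tl-pick v)) (==-refl v)))
      λ e p → let f , eq = ∧-elim (F e) p in only v e f (sym (==⇒≡ eq))
    deg′ : ∀ v → outdeg (A ∖ F) v ≡ q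
    deg′ v = +-cancelʳ-≡ 1 _ _ (trans (cong (outdeg (A ∖ F) v +_) (sym (deg-F v)))
      (trans (sym (outdeg-∖ A F F⊆A v)) (trans (deg v) (+-comm 1 q))))

  -- Trees get the colours below `ℓ`; maps are taken from the remainder `R`, with colours shifted by
  -- `ℓ`. Every arc is coloured because the final remainder `Z` has out-degree 0 everywhere.
  decompose : ∀ r q ℓ → RootConnected r ℓ (λ _ → true) →
    (∀ v → outdeg (λ _ → true) v ≡ q + ℓ * χ (not (v == r))) → MapsAndTrees (ℓ + q) ℓ G
  decompose r q ℓ conn deg
    with R , trees , _ , degR ← peel {Good = λ F → SpanningTree G (λ e → F e ≡ true)} (TreeInv r q) (peelTree r q) ℓ _ (conn , deg)
    -- With no tree left to take, the tree invariant gives out-degree `q` at every vertex, the root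
    -- included.
    with Z , maps , degZ ← peel {Good = λ F → MapGraph G (λ e → F e ≡ true)} MapInv peelMap q R (λ v → trans (degR v) (+-identityʳ q))
    = col , treeClass , mapClass
    where
    open Peeling
    Z-empty : ∀ e → Z e ≡ false
    Z-empty e with Z e in eq
    ... | false = refl
    ... | true  = contradiction (≤-trans (∃⇒card-positive _ e (∧-intro eq (==-refl (tl e)))) (≤-reflexive (degZ (tl e)))) λ ()
    c : Fin (m G) → ℕ
    c e = if R e then ℓ + colour maps e else colour trees e
    c< : ∀ e → c e < ℓ + q
    c< e with R e in eq
    ... | true  = +-monoʳ-< ℓ (bound maps e eq (Z-empty e))
    ... | false = ≤-trans (bound trees e refl eq) (m≤m+n ℓ q)
    col : Fin (m G) → Fin (ℓ + q)
    col e = fromℕ< (c< e)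
    col⇒c : ∀ {e i} → col e ≡ i → c e ≡ toℕ i
    col⇒c {e} refl = sym (toℕ-fromℕ< (c< e))
    c⇒col : ∀ {e i} → c e ≡ toℕ i → col e ≡ i
    c⇒col {e} eq = toℕ-injective (trans (toℕ-fromℕ< (c< e)) eq)

    treeClass : ∀ i → toℕ i < ℓ → SpanningTree G (λ e → col e ≡ i)
    treeClass i lt with F , good , forth , back ← class trees (toℕ i) lt = resp-spanningTree to from good
      where
      to : ∀ e → F e ≡ true → col e ≡ i
      to e f with _ , r∉ , eq ← forth e f = c⇒col (trans (cong (λ b → if b then ℓ + colour maps e else colour trees e) r∉) eq)
      from : ∀ e → col e ≡ i → F e ≡ true
      from e eq with R e in r | col⇒c eq
      ... | false | eq′ = back e refl r eq′
      ... | true  | eq′ = contradiction (≤-trans lt (m≤m+n ℓ _)) (<-irrefl (sym eq′))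

    mapClass : ∀ i → ℓ ≤ toℕ i → MapGraph G (λ e → col e ≡ i)
    mapClass i ge with d , eqi ← m≤n⇒∃[o]m+o≡n ge
      with F , good , forth , back ← class maps d (+-cancelˡ-< ℓ d q (subst (_< ℓ + q) (sym eqi) (toℕ<n i))) =
      resp-mapGraph to from good
      where
      to : ∀ e → F e ≡ true → col e ≡ i
      to e f with r∈ , _ , eq ← forth e f = c⇒col (trans (cong (λ b → if b then ℓ + colour maps e else colour trees e) r∈) (trans (cong (ℓ +_) eq) eqi))
      from : ∀ e → col e ≡ i → F e ≡ true
      from e eq with R e in r | col⇒c eq
      ... | true  | eq′ = back e r (Z-empty e) (+-cancelˡ-≡ ℓ _ _ (trans eq′ (sym eqi)))
      ... | false | eq′ = contradiction (≤-trans (bound trees e refl r) ge) (<-irrefl eq′)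

-- The pebble game

∑ₗ : {A : Set} → (A → ℕ) → List A → ℕ
∑ₗ f xs = ListAction.sum (List.map f xs)

∑ₗ-tabulate : ∀ {A : Set} {m} (f : A → ℕ) (g : Fin m → A) → ∑ₗ f (List.tabulate g) ≡ ∑ (f ∘ g)
∑ₗ-tabulate {m = zero}  f g = sym (∑-empty _)
∑ₗ-tabulate {m = suc m} f g = trans (cong (f (g zero) +_) (∑ₗ-tabulate f (g ∘ suc))) (sym (∑-suc _))

module _ {A : Set} where

  ∑ₗ-∷= : ∀ (f : A → ℕ) xs i y → ∑ₗ f (xs [ i ]∷= y) + f (List.lookup xs i) ≡ ∑ₗ f xs + f y
  ∑ₗ-∷= f (x ∷ xs) zero y = solve 3 (λ a b c → a :+ b :+ c := c :+ b :+ a) refl (f y) (∑ₗ f xs) (f x)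
    where open +-*-Solver
  ∑ₗ-∷= f (x ∷ xs) (suc i) y = begin
    f x + ∑ₗ f (xs [ i ]∷= y) + f (List.lookup xs i)      ≡⟨ +-assoc (f x) _ _ ⟩
    f x + (∑ₗ f (xs [ i ]∷= y) + f (List.lookup xs i))    ≡⟨ cong (f x +_) (∑ₗ-∷= f xs i y) ⟩
    f x + (∑ₗ f xs + f y)                                 ≡⟨ +-assoc (f x) _ _ ⟨
    f x + ∑ₗ f xs + f y                                   ∎
    where open ≡-Reasoning

  ∈-∷= : ∀ {x : A} {xs} i {y} → x ∈ₗ xs → x ≢ List.lookup xs i → x ∈ₗ xs [ i ]∷= y
  ∈-∷= zero    (here eq)   ne = contradiction eq ne
  ∈-∷= zero    (there x∈)  ne = there x∈
  ∈-∷= (suc i) (here eq)   ne = here eq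
  ∈-∷= (suc i) (there x∈)  ne = there (∈-∷= i x∈ ne)

  Pointwise-∷= : ∀ {B : Set} {R : B → A → Set} {ys xs} i {y} → Pointwise R ys xs →
                 (∀ b → R b (List.lookup xs i) → R b y) → Pointwise R ys (xs [ i ]∷= y)
  Pointwise-∷= zero    (r ∷ rs) imp = imp _ r ∷ rs
  Pointwise-∷= (suc i) (r ∷ rs) imp = r ∷ Pointwise-∷= i rs imp

module _ {n k : ℕ} where

  δ-χ : ∀ (v : Fin n) (c : Fin k) x d → δ v c x d ≡ χ (x == v) * χ (d == c)
  δ-χ v c x d rewrite isYes≗does (x ≟ v) | isYes≗does (d ≟ c) with x == v | d == c
  ... | true  | true  = refl
  ... | true  | false = refl
  ... | false | _     = refl

  δ≤ : ∀ {v : Fin n} {c : Fin k} {f : Fin n → Fin k → ℕ} → 1 ≤ f v c → ∀ x d → δ v c x d ≤ f x d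
  δ≤ {v} {c} pos x d with x ≟ v | d ≟ c
  ... | yes refl | yes refl = pos
  ... | yes _    | no _     = z≤n
  ... | no _     | yes _    = z≤n
  ... | no _     | no _     = z≤n

pebTotal-∑ : ∀ {n k} (P : Fin n → Fin k → ℕ) v → pebTotal P v ≡ ∑ (P v)
pebTotal-∑ {k = zero}  P v = sym (∑-empty _)
pebTotal-∑ {k = suc k} P v = trans (cong (P v zero +_) (pebTotal-∑ (λ x c → P x (suc c)) v)) (sym (∑-suc _))

pebTotal-+ : ∀ {n k} (P Q : Fin n → Fin k → ℕ) v → pebTotal (λ x d → P x d + Q x d) v ≡ pebTotal P v + pebTotal Q v
pebTotal-+ P Q v = trans (pebTotal-∑ _ v) (trans (∑-+ (P v) (Q v)) (sym (cong₂ _+_ (pebTotal-∑ P v) (pebTotal-∑ Q v))))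

pebTotal-cong : ∀ {n k} {P Q : Fin n → Fin k → ℕ} → (∀ x d → P x d ≡ Q x d) → ∀ v → pebTotal P v ≡ pebTotal Q v
pebTotal-cong eq v = trans (pebTotal-∑ _ v) (trans (∑-cong (eq v)) (sym (pebTotal-∑ _ v)))

pebTotal-δ : ∀ {n k} (v : Fin n) (c : Fin k) x → pebTotal (δ v c) x ≡ χ (x == v)
pebTotal-δ v c x = trans (pebTotal-∑ (δ v c) x) (trans (∑-cong (δ-χ v c x)) (∑-δ (λ _ → χ (x == v)) c))

pebbleAt : ∀ {n k} (P : Fin n → Fin k → ℕ) v → 1 ≤ pebTotal P v → ∃ λ c → 1 ≤ P v c
pebbleAt {k = k} P v pos = ∑-<⇒∃< (λ _ → 0) (P v)
  (subst₂ _<_ (sym (∑-zero {k} _ λ _ → refl)) (pebTotal-∑ P v) pos)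

pair : ∀ {n} → Fin n → Fin n → Fin n → Bool
pair v w y = (y == v) ∨ (y == w)

pebOnSet-∑ : ∀ {n k} (P : Fin n → Fin k → ℕ) v w → pebOnSet P v w ≡ ∑ (λ y → χ (pair v w y) * pebTotal P y)
pebOnSet-∑ P v w with v ≟ w
... | yes refl = sym (trans (∑-cong λ y → trans (cong (λ b → χ b * pebTotal P y) (∨-idem (y == v))) (*-comm (χ (y == v)) (pebTotal P y)))
                            (∑-δ (pebTotal P) v))
... | no v≢w = sym (begin
    ∑ (λ y → χ (pair v w y) * pebTotal P y)                              ≡⟨ ∑-cong split ⟩
    ∑ (λ y → pebTotal P y * χ (y == v) + pebTotal P y * χ (y == w))      ≡⟨ ∑-+ (λ y → pebTotal P y * χ (y == v)) (λ y → pebTotal P y * χ (y == w)) ⟩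
    ∑ (λ y → pebTotal P y * χ (y == v)) + ∑ (λ y → pebTotal P y * χ (y == w))
                                                                         ≡⟨ cong₂ _+_ (∑-δ (pebTotal P) v) (∑-δ (pebTotal P) w) ⟩
    pebTotal P v + pebTotal P w                                          ∎)
  where
  open ≡-Reasoning
  disjoint : ∀ y → χ (pair v w y) ≡ χ (y == v) + χ (y == w)
  disjoint y with y ≟ v | y ≟ w
  ... | yes refl | yes refl = contradiction refl v≢w
  ... | yes _    | no _     = refl
  ... | no _     | yes _    = refl
  ... | no _     | no _     = refl
  split : ∀ y → χ (pair v w y) * pebTotal P y ≡ pebTotal P y * χ (y == v) + pebTotal P y * χ (y == w)
  split y = trans (cong (_* pebTotal P y) (disjoint y))
    (trans (*-comm _ (pebTotal P y)) (*-distribˡ-+ (pebTotal P y) (χ (y == v)) (χ (y == w))))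

pebOnSet-sym : ∀ {n k} (P : Fin n → Fin k → ℕ) v w → pebOnSet P v w ≡ pebOnSet P w v
pebOnSet-sym P v w = trans (pebOnSet-∑ P v w) (trans
  (∑-cong λ y → cong (λ b → χ b * pebTotal P y) (∨-comm (y == v) (y == w))) (sym (pebOnSet-∑ P w v)))

pebOnSet≤∑ : ∀ {n k} (P : Fin n → Fin k → ℕ) v w → pebOnSet P v w ≤ ∑ (pebTotal P)
pebOnSet≤∑ P v w = ≤-trans (≤-reflexive (pebOnSet-∑ P v w)) (∑-mono λ y → pointwise (pair v w y) (pebTotal P y))
  where
  pointwise : ∀ b t → χ b * t ≤ t
  pointwise true  t = ≤-reflexive (+-identityʳ t)
  pointwise false t = z≤n

data Route {n : ℕ} (Step : Fin n → Fin n → Set) (a : Fin n) : ℕ → Fin n → Set where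
  stay : Route Step a 0 a
  _▷_  : ∀ {l b c} → Route Step a l b → Step b c → Route Step a (suc l) c

mapRoute : ∀ {n} {S S′ : Fin n → Fin n → Set} {a l b} → (∀ {u v} → S u v → S′ u v) → Route S a l b → Route S′ a l b
mapRoute f stay    = stay
mapRoute f (R ▷ s) = mapRoute f R ▷ f s

firstVisit : ∀ {n} {S : Fin n → Fin n → Set} {a l b} x → Route S a l b →
             (∃ λ l′ → l′ ≤ l × Route S a l′ x) ⊎ (b ≢ x × Route (λ u v → S u v × v ≢ x) a l b)
firstVisit {b = b} x R with b ≟ x
... | yes refl = inj₁ (_ , ≤-refl , R)
firstVisit x stay    | no b≢x = inj₂ (b≢x , stay)
firstVisit x (R ▷ s) | no b≢x with firstVisit x R
... | inj₁ (l′ , le , R′) = inj₁ (l′ , m≤n⇒m≤1+n le , R′)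
... | inj₂ (_ , R′)       = inj₂ (b≢x , R′ ▷ (s , b≢x))

-- Heads of arcs leaving the set are added until no arc leaves. The property `Q`, inherited along
-- arcs, will be the existence of a route from the starting set, so every member of the result comes
-- with a route.
closure : ∀ {n} {A : Set} (xs : List (Fin n × Fin n × A)) (Q : Fin n → Set) →
  (∀ {u v c} → (u , v , c) ∈ₗ xs → Q u → Q v) → (S : Fin n → Bool) → (∀ x → S x ≡ true → Q x) →
  ∃ λ S′ → (∀ x → S x ≡ true → S′ x ≡ true) × (∀ x → S′ x ≡ true → Q x) ×
           All (λ a → S′ (proj₁ a) ≡ true → S′ (proj₁ (proj₂ a)) ≡ true) xs
closure {n} {A} xs Q Q-closed S S⊆Q = loop n S S⊆Q (≤-trans (card-mono (not ∘ S) (λ _ → true) λ _ _ → refl) (≤-reflexive (card-full n)))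
  where
  Result : (Fin n → Bool) → Set
  Result S = ∃ λ S′ → (∀ x → S x ≡ true → S′ x ≡ true) × (∀ x → S′ x ≡ true → Q x) ×
             All (λ a → S′ (proj₁ a) ≡ true → S′ (proj₁ (proj₂ a)) ≡ true) xs
  loop : ∀ fuel S → (∀ x → S x ≡ true → Q x) → card (not ∘ S) ≤ fuel → Result S
  loop fuel S S⊆Q bound
    with Any.any? (λ a → (S (proj₁ a) Bool.≟ true) ×-dec (S (proj₁ (proj₂ a)) Bool.≟ false)) xs
  ... | no none = S , (λ _ p → p) , S⊆Q ,
      All.tabulate λ a∈ u∈ → ¬-not λ v∉ → none (Any.map (λ { refl → u∈ , v∉ }) a∈)
  loop fuel S S⊆Q bound | yes some with (u , v , c) , a∈ , u∈ , v∉ ← find some = extended fuel bound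
    where
    step : ∀ x → add S v x ≡ true → Q x
    step x x∈ with ∨-elim (S x) x∈
    ... | inj₁ p = S⊆Q x p
    ... | inj₂ eq with refl ← ==⇒≡ {x = x} eq = Q-closed a∈ (S⊆Q u u∈)
    smaller : card (not ∘ add S v) < card (not ∘ S)
    smaller = card-complement-add S v v∉
    extended : ∀ fuel → card (not ∘ S) ≤ fuel → Result S
    extended zero bound = contradiction (≤-trans smaller bound) λ ()
    extended (suc fuel) bound with S′ , inc , rest ← loop fuel (add S v) step (≤-pred (≤-trans smaller bound)) =
      S′ , (λ x p → inc x (∨-introˡ p)) , rest

insideₗ : ∀ {n} → (Fin n → Bool) → List (Fin n × Fin n) → ℕ
insideₗ S = ∑ₗ (λ e → χ (S (proj₁ e) ∧ S (proj₂ e)))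

module _ {n k : ℕ} where

  Flip : Fin n × Fin n → Fin n × Fin n × Fin k → Set
  Flip e (x , y , _) = e ≡ (x , y) ⊎ e ≡ (y , x)

  outₗ : Fin n → List (Fin n × Fin n × Fin k) → ℕ
  outₗ x = ∑ₗ (λ a → χ (x == proj₁ a))

  insideₗ-flip : ∀ S {L H} → Pointwise Flip L H → insideₗ S L ≡ ∑ₗ (λ a → χ (S (proj₁ a) ∧ S (proj₁ (proj₂ a)))) H
  insideₗ-flip S []       = refl
  insideₗ-flip S (inj₁ refl ∷ fs) = cong₂ _+_ refl (insideₗ-flip S fs)
  insideₗ-flip S {H = (x , y , _) ∷ _} (inj₂ refl ∷ fs) = cong₂ _+_ (cong χ (∧-comm (S y) (S x))) (insideₗ-flip S fs)

  ∑-outₗ : ∀ S H → ∑ (λ x → χ (S x) * outₗ x H) ≡ ∑ₗ (λ a → χ (S (proj₁ a))) H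
  ∑-outₗ S [] = ∑-zero _ λ x → *-zeroʳ (χ (S x))
  ∑-outₗ S (a ∷ H) = begin
    ∑ (λ x → χ (S x) * (χ (x == proj₁ a) + outₗ x H))                       ≡⟨ ∑-cong (λ x → *-distribˡ-+ (χ (S x)) _ _) ⟩
    ∑ (λ x → χ (S x) * χ (x == proj₁ a) + χ (S x) * outₗ x H)               ≡⟨ ∑-+ (λ x → χ (S x) * χ (x == proj₁ a)) (λ x → χ (S x) * outₗ x H) ⟩
    ∑ (λ x → χ (S x) * χ (x == proj₁ a)) + ∑ (λ x → χ (S x) * outₗ x H)     ≡⟨ cong₂ _+_ (∑-δ (χ ∘ S) (proj₁ a)) (∑-outₗ S H) ⟩
    χ (S (proj₁ a)) + ∑ₗ (λ a → χ (S (proj₁ a))) H                          ∎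
    where open ≡-Reasoning

∑-χ-* : ∀ {n} (S : Fin n → Bool) k → ∑ (λ x → χ (S x) * k) ≡ k * card S
∑-χ-* S k = trans (∑-cong λ x → *-comm (χ (S x)) k) (sym (∑-*ˡ k (χ ∘ S)))

-- Configurations and the transport of pebbles

module Game (n k ℓ : ℕ) where

  -- A reachable state whose arcs stand in the same order as the edges in `L`, up to direction.
  -- Slides overwrite an arc in place, so the position keeps identifying the edge.
  record Config (L : List (Fin n × Fin n)) : Set where
    field
      arcs      : List (Fin n × Fin n × Fin k)
      pebbles   : Fin n → Fin k → ℕ
      reachable : Star (Move ℓ) (initial n k) ⟨ arcs , pebbles ⟩
      balance   : ∀ x → pebTotal pebbles x + outₗ x arcs ≡ k
      flips     : Pointwise Flip L arcs

    total : Fin n → ℕ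
    total = pebTotal pebbles

    Step : Fin n → Fin n → Set
    Step u v = ∃ λ c → (u , v , c) ∈ₗ arcs
  open Config

  noEdges : Config []
  noEdges = record
    { arcs = [] ; pebbles = λ _ _ → 1 ; reachable = ε
    ; balance = λ x → trans (+-identityʳ _) (trans (pebTotal-∑ {k = k} (λ _ _ → 1) x) (trans (∑-const k 1) (*-identityʳ k)))
    ; flips = [] }

  addArc : ∀ {L} (C : Config L) e v w → e ≡ (v , w) ⊎ e ≡ (w , v) → 1 ≤ total C v → suc ℓ ≤ pebOnSet (pebbles C) v w → Config (e ∷ L)
  addArc C e v w flip pos enough with c , has ← pebbleAt (pebbles C) v pos = record
    { arcs = (v , w , c) ∷ arcs C
    ; pebbles = P′
    ; reachable = reachable C ◅◅ (add-edge v w c has enough eq ◅ ε)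
    ; balance = λ x → trans (sym (+-assoc (pebTotal P′ x) _ _)) (trans (cong (_+ outₗ x (arcs C)) (total′ x)) (balance C x))
    ; flips = flip ∷ flips C }
    where
    P′ : Fin n → Fin k → ℕ
    P′ x d = pebbles C x d ∸ δ v c x d
    eq : ∀ x d → P′ x d + δ v c x d ≡ pebbles C x d
    eq x d = m∸n+n≡m (δ≤ {f = pebbles C} has x d)
    total′ : ∀ x → pebTotal P′ x + χ (x == v) ≡ total C x
    total′ x = trans (cong (pebTotal P′ x +_) (sym (pebTotal-δ v c x))) (trans (sym (pebTotal-+ P′ (δ v c) x)) (pebTotal-cong eq x))

  -- The move requires a pebble on the tail, whereas the bound only speaks of the pair; the edge is
  -- directed out of an end that has one.
  addEdge : ∀ {L} (C : Config L) v w → suc ℓ ≤ pebOnSet (pebbles C) v w → Config ((v , w) ∷ L)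
  addEdge C v w enough
    with y , lt ← ∑-<⇒∃< (λ _ → 0) (λ y → χ (pair v w y) * total C y)
           (subst₂ _<_ (sym (∑-zero {n} _ λ _ → refl)) (pebOnSet-∑ (pebbles C) v w) (≤-trans (s≤s z≤n) enough))
    with y ≟ v | y ≟ w
  ... | yes refl | _ = addArc C (v , w) v w (inj₁ refl) (≤-trans lt (≤-reflexive (+-identityʳ _))) enough
  ... | no _ | yes refl = addArc C (v , w) w v (inj₂ refl) (≤-trans lt (≤-reflexive (+-identityʳ _)))
                            (≤-trans enough (≤-reflexive (pebOnSet-sym (pebbles C) v w)))

  slide : ∀ {L} (C : Config L) {v w c} → (v , w , c) ∈ₗ arcs C → 1 ≤ total C w →
    Σ (Config L) λ C′ → (∀ y → total C′ y + χ (y == w) ≡ total C y + χ (y == v))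
                      × (∀ {u x} → Step C u x → x ≢ w → Step C′ u x)
  slide C {v} {w} {c} a∈ pos with c′ , has ← pebbleAt (pebbles C) w pos = record
    { arcs = arcs′
    ; pebbles = P′
    ; reachable = reachable C ◅◅ (pebble-slide i v w c c′ (sym at-i) has eq ◅ ε)
    ; balance = λ x → trans (+-cancelʳ-≡ (χ (x == w) + χ (x == v)) _ _ (begin
          pebTotal P′ x + outₗ x arcs′ + (χ (x == w) + χ (x == v))
            ≡⟨ shuffle (pebTotal P′ x) (outₗ x arcs′) (χ (x == w)) (χ (x == v)) ⟩
          (pebTotal P′ x + χ (x == w)) + (outₗ x arcs′ + χ (x == v))
            ≡⟨ cong₂ _+_ (total′ x) (out′ x) ⟩
          (total C x + χ (x == v)) + (outₗ x (arcs C) + χ (x == w))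
            ≡⟨ shuffle (total C x) (outₗ x (arcs C)) (χ (x == v)) (χ (x == w)) ⟨
          total C x + outₗ x (arcs C) + (χ (x == v) + χ (x == w))
            ≡⟨ cong (total C x + outₗ x (arcs C) +_) (+-comm (χ (x == v)) _) ⟩
          total C x + outₗ x (arcs C) + (χ (x == w) + χ (x == v)) ∎)) (balance C x)
    ; flips = Pointwise-∷= i (flips C) λ e f → flipped e (subst (Flip e) (sym at-i) f)
    -- An arc whose head is not `w` differs from the reversed arc and therefore survives.
    } , total′ , λ (d , b∈) x≢w → d , ∈-∷= i b∈ (λ b≡ → x≢w (cong (proj₁ ∘ proj₂) (trans b≡ (sym at-i))))
    where
    open ≡-Reasoning
    shuffle : ∀ a b c d → a + b + (c + d) ≡ (a + c) + (b + d)
    shuffle = solve 4 (λ a b c d → a :+ b :+ (c :+ d) := (a :+ c) :+ (b :+ d)) refl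
      where open +-*-Solver
    i = Any.index a∈
    at-i : (v , w , c) ≡ List.lookup (arcs C) i
    at-i = lookup-index a∈
    arcs′ = arcs C [ i ]∷= (w , v , c′)
    P′ : Fin n → Fin k → ℕ
    P′ x d = pebbles C x d + δ v c x d ∸ δ w c′ x d
    eq : ∀ x d → P′ x d + δ w c′ x d ≡ pebbles C x d + δ v c x d
    eq x d = m∸n+n≡m (≤-trans (δ≤ {f = pebbles C} has x d) (m≤m+n _ _))
    total′ : ∀ x → pebTotal P′ x + χ (x == w) ≡ total C x + χ (x == v)
    total′ x = begin
      pebTotal P′ x + χ (x == w)                       ≡⟨ cong (pebTotal P′ x +_) (pebTotal-δ w c′ x) ⟨
      pebTotal P′ x + pebTotal (δ w c′) x              ≡⟨ pebTotal-+ P′ (δ w c′) x ⟨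
      pebTotal (λ x d → P′ x d + δ w c′ x d) x         ≡⟨ pebTotal-cong eq x ⟩
      pebTotal (λ x d → pebbles C x d + δ v c x d) x   ≡⟨ pebTotal-+ (pebbles C) (δ v c) x ⟩
      total C x + pebTotal (δ v c) x                   ≡⟨ cong (total C x +_) (pebTotal-δ v c x) ⟩
      total C x + χ (x == v)                           ∎
    out′ : ∀ x → outₗ x arcs′ + χ (x == v) ≡ outₗ x (arcs C) + χ (x == w)
    out′ x = trans (cong (λ a → outₗ x arcs′ + χ (x == proj₁ a)) at-i)
                   (∑ₗ-∷= (λ a → χ (x == proj₁ a)) (arcs C) i (w , v , c′))
    flipped : ∀ e → Flip {k = k} e (v , w , c) → Flip {k = k} e (w , v , c′)
    flipped e (inj₁ p) = inj₂ p
    flipped e (inj₂ p) = inj₁ p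

  received : ∀ {b x : Fin n} → b ≢ x → (τ τ′ : Fin n → ℕ) → τ′ b + χ (b == x) ≡ τ b + χ (b == b) → 1 ≤ τ′ b
  received {b} {x} b≢x τ τ′ eq = begin
    1                    ≡⟨ cong χ (==-refl b) ⟨
    χ (b == b)           ≤⟨ m≤n+m _ (τ b) ⟩
    τ b + χ (b == b)     ≡⟨ eq ⟨
    τ′ b + χ (b == x)    ≡⟨ cong (λ z → τ′ b + χ z) (≢⇒== b≢x) ⟩
    τ′ b + 0             ≡⟨ +-identityʳ _ ⟩
    τ′ b                 ∎
    where open ≤-Reasoning

  -- Cutting the route at its first visit to x keeps the arcs before the last one intact when that one is reversed.
  bring : ∀ {L} fuel {l a x} → l ≤ fuel → (C : Config L) → Route (Step C) a l x → 1 ≤ total C x →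
    Σ (Config L) λ C′ → ∀ y → total C′ y + χ (y == x) ≡ total C y + χ (y == a)
  bring fuel le C stay pos = C , λ y → refl
  bring (suc fuel) {suc l} {a} {x} (s≤s le) C (_▷_ {b = b} R (c , b→x)) pos with firstVisit x R
  ... | inj₁ (l′ , l′≤l , R′) = bring fuel (≤-trans l′≤l le) C R′ pos
  ... | inj₂ (b≢x , R′)
      with C₁ , total₁ , keep ← slide C b→x pos
      with C₂ , total₂ ← bring fuel le C₁ (mapRoute (λ (s , ≢x) → keep s ≢x) R′) (received b≢x (total C) (total C₁) (total₁ b))
      = C₂ , λ y → +-cancelʳ-≡ (χ (y == b)) _ _ (begin
          total C₂ y + χ (y == x) + χ (y == b)       ≡⟨ swap (total C₂ y) (χ (y == x)) (χ (y == b)) ⟩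
          total C₂ y + χ (y == b) + χ (y == x)       ≡⟨ cong (_+ χ (y == x)) (total₂ y) ⟩
          total C₁ y + χ (y == a) + χ (y == x)       ≡⟨ swap (total C₁ y) (χ (y == a)) (χ (y == x)) ⟩
          total C₁ y + χ (y == x) + χ (y == a)       ≡⟨ cong (_+ χ (y == a)) (total₁ y) ⟩
          total C y + χ (y == b) + χ (y == a)        ≡⟨ swap (total C y) (χ (y == b)) (χ (y == a)) ⟩
          total C y + χ (y == a) + χ (y == b)        ∎)
    where
    open ≡-Reasoning
    swap : ∀ p q s → p + q + s ≡ p + s + q
    swap = solve 3 (λ p q s → p :+ q :+ s := p :+ s :+ q) refl
      where open +-*-Solver

  reservoir : ∀ {L} (C : Config L) S →
    All (λ a → S (proj₁ a) ≡ true → S (proj₁ (proj₂ a)) ≡ true) (arcs C) →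
    ∑ (λ x → χ (S x) * total C x) + insideₗ S L ≡ k * card S
  reservoir {L} C S closed = begin
    ∑ (λ x → χ (S x) * total C x) + insideₗ S L
      ≡⟨ cong (∑ (λ x → χ (S x) * total C x) +_) (trans (insideₗ-flip S (flips C)) (sym (trans (∑-outₗ S (arcs C)) (heads closed)))) ⟩
    ∑ (λ x → χ (S x) * total C x) + ∑ (λ x → χ (S x) * outₗ x (arcs C))
      ≡⟨ ∑-+ (λ x → χ (S x) * total C x) (λ x → χ (S x) * outₗ x (arcs C)) ⟨
    ∑ (λ x → χ (S x) * total C x + χ (S x) * outₗ x (arcs C))
      ≡⟨ ∑-cong (λ x → trans (sym (*-distribˡ-+ (χ (S x)) _ _)) (cong (χ (S x) *_) (balance C x))) ⟩
    ∑ (λ x → χ (S x) * k)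
      ≡⟨ ∑-χ-* S k ⟩
    k * card S ∎
    where
    open ≡-Reasoning
    heads : ∀ {H : List (Fin n × Fin n × Fin k)} → All (λ a → S (proj₁ a) ≡ true → S (proj₁ (proj₂ a)) ≡ true) H →
            ∑ₗ (λ a → χ (S (proj₁ a))) H ≡ ∑ₗ (λ a → χ (S (proj₁ a) ∧ S (proj₁ (proj₂ a)))) H
    heads [] = refl
    heads {a ∷ H} (p ∷ ps) = cong₂ _+_ (pointwise (S (proj₁ a)) p) (heads ps)
      where
      pointwise : ∀ b {b′} → (b ≡ true → b′ ≡ true) → χ b ≡ χ (b ∧ b′)
      pointwise true  imp rewrite imp refl = refl
      pointwise false imp = refl

  module _ {L : List (Fin n × Fin n)} (v w : Fin n) where

    private
      W = pair v w

    distantPebble : ∀ t → (∀ S → S v ≡ true → S w ≡ true → insideₗ S L + t ≤ k * card S) →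
      (C : Config L) → pebOnSet (pebbles C) v w < t →
      ∃ λ x → W x ≡ false × 1 ≤ total C x × ∃ λ a → W a ≡ true × ∃ λ l → Route (Step C) a l x
    distantPebble t sparse C few =
      let S , W⊆S , S⊆Q , closed = closure (arcs C) (λ x → ∃ λ a → W a ≡ true × ∃ λ l → Route (Step C) a l x)
            (λ s (a , a∈ , l , R) → a , a∈ , suc l , R ▷ (_ , s)) W (λ x x∈ → x , x∈ , 0 , stay)
          x , lt = ∑-<⇒∃< (λ y → χ (W y) * total C y) (λ y → χ (S y) * total C y) (more S W⊆S closed)
          x∉W , x∈S , pos = outside (W x) (S x) (total C x) lt
      in x , x∉W , pos , S⊆Q x x∈S
      where
      open ≤-Reasoning
      more : ∀ S → (∀ x → W x ≡ true → S x ≡ true) → All (λ a → S (proj₁ a) ≡ true → S (proj₁ (proj₂ a)) ≡ true) (arcs C) →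
             ∑ (λ y → χ (W y) * total C y) < ∑ (λ y → χ (S y) * total C y)
      more S W⊆S closed = begin-strict
        ∑ (λ y → χ (W y) * total C y)    ≡⟨ pebOnSet-∑ (pebbles C) v w ⟨
        pebOnSet (pebbles C) v w         <⟨ few ⟩
        t                                ≤⟨ +-cancelʳ-≤ (insideₗ S L) _ _ (begin
            t + insideₗ S L                                  ≡⟨ +-comm t _ ⟩
            insideₗ S L + t                                  ≤⟨ sparse S (W⊆S v (∨-introˡ (==-refl v))) (W⊆S w (∨-introʳ (w == v) (==-refl w))) ⟩
            k * card S                                       ≡⟨ reservoir C S closed ⟨
            ∑ (λ x → χ (S x) * total C x) + insideₗ S L      ∎) ⟩
        ∑ (λ y → χ (S y) * total C y)    ∎
      outside : ∀ b s p → χ b * p < χ s * p → b ≡ false × s ≡ true × 1 ≤ p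
      outside false true p lt = refl , refl , ≤-trans lt (≤-reflexive (+-identityʳ p))
      outside true  true p lt = contradiction lt (<-irrefl refl)

    gain : ∀ (C C′ : Config L) {x a} → W x ≡ false → W a ≡ true →
           (∀ y → total C′ y + χ (y == x) ≡ total C y + χ (y == a)) →
           pebOnSet (pebbles C′) v w ≡ pebOnSet (pebbles C) v w + 1
    gain C C′ {x} {a} x∉ a∈ eq = begin
      pebOnSet (pebbles C′) v w                        ≡⟨ pebOnSet-∑ (pebbles C′) v w ⟩
      ∑ (λ y → χ (W y) * total C′ y)                   ≡⟨ +-identityʳ _ ⟨
      ∑ (λ y → χ (W y) * total C′ y) + 0               ≡⟨ cong (λ b → ∑ (λ y → χ (W y) * total C′ y) + χ b) x∉ ⟨
      ∑ (λ y → χ (W y) * total C′ y) + χ (W x)         ≡⟨ weigh C′ x ⟨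
      ∑ (λ y → χ (W y) * (total C′ y + χ (y == x)))    ≡⟨ ∑-cong (λ y → cong (χ (W y) *_) (eq y)) ⟩
      ∑ (λ y → χ (W y) * (total C y + χ (y == a)))     ≡⟨ weigh C a ⟩
      ∑ (λ y → χ (W y) * total C y) + χ (W a)          ≡⟨ cong₂ _+_ (sym (pebOnSet-∑ (pebbles C) v w)) (cong χ a∈) ⟩
      pebOnSet (pebbles C) v w + 1                     ∎
      where
      open ≡-Reasoning
      weigh : ∀ (C : Config L) z → ∑ (λ y → χ (W y) * (total C y + χ (y == z))) ≡ ∑ (λ y → χ (W y) * total C y) + χ (W z)
      weigh C z = trans (∑-cong λ y → *-distribˡ-+ (χ (W y)) _ _)
        (trans (∑-+ (λ y → χ (W y) * total C y) (λ y → χ (W y) * χ (y == z)))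
               (cong (∑ (λ y → χ (W y) * total C y) +_) (∑-δ (χ ∘ W) z)))

    -- Each round brings one more pebble to the pair, so the deficit `d` serves as fuel. The target
    -- `t` is `suc ℓ` when an edge is to be added and `ℓ` for the final concentration on one vertex.
    gather : ∀ t → (∀ S → S v ≡ true → S w ≡ true → insideₗ S L + t ≤ k * card S) →
      Config L → Σ (Config L) λ C → t ≤ pebOnSet (pebbles C) v w
    gather t sparse C = loop t C (m≤n+m t _)
      where
      loop : ∀ d (C : Config L) → t ≤ pebOnSet (pebbles C) v w + d → Σ (Config L) λ C′ → t ≤ pebOnSet (pebbles C′) v w
      loop d C le with t ≤? pebOnSet (pebbles C) v w
      ... | yes enough = C , enough
      loop zero C le | no few = contradiction (≤-trans le (≤-reflexive (+-identityʳ _))) few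
      loop (suc d) C le | no few
        with x , x∉W , pos , a , a∈ , l , R ← distantPebble t sparse C (≰⇒> few)
        with C′ , total′ ← bring l ≤-refl C R pos
        = loop d C′ (begin
            t                                        ≤⟨ le ⟩
            pebOnSet (pebbles C) v w + suc d         ≡⟨ +-assoc _ 1 d ⟨
            pebOnSet (pebbles C) v w + 1 + d         ≡⟨ cong (_+ d) (gain C C′ x∉W a∈ total′) ⟨
            pebOnSet (pebbles C′) v w + d            ∎)
        where open ≤-Reasoning

  Sparseₗ : List (Fin n × Fin n) → Set
  Sparseₗ L = ∀ S → 1 ≤ insideₗ S L → insideₗ S L + ℓ ≤ k * card S

  build : ∀ L → Sparseₗ L → Config L
  build [] _ = noEdges
  build ((v , w) ∷ L) sparse =
    let C , enough = gather v w (suc ℓ) room (build L λ S pos → ≤-trans (+-monoˡ-≤ ℓ (m≤n+m _ _)) (sparse S (≤-trans pos (m≤n+m _ _))))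
    in addEdge C v w enough
    where
    -- The extra unit is the edge about to be added: it lies inside `S`, so sparsity of the longer
    -- list counts it and also applies to `S` when no earlier edge does.
    room : ∀ S → S v ≡ true → S w ≡ true → insideₗ S L + suc ℓ ≤ k * card S
    room S v∈ w∈ with sparse S
    ... | bound rewrite v∈ | w∈ = ≤-trans (≤-reflexive (+-suc _ ℓ)) (bound (s≤s z≤n))

-- The equivalence

-- Turns the positional matching of edges and arcs into a bijection of indices, and sums over arcs
-- into sums over edges of the graph.
arcOf : ∀ {n k m} (g : Fin m → Fin n × Fin n) {H : List (Fin n × Fin n × Fin k)} → Pointwise Flip (List.tabulate g) H →
  Σ (m ≡ List.length H) λ eq → (∀ e → Flip (g e) (List.lookup H (cast eq e))) ×
    (∀ f → ∑ₗ f H ≡ ∑ (λ e → f (List.lookup H (cast eq e))))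
arcOf {m = zero}  g [] = refl , (λ ()) , λ f → sym (∑-empty _)
arcOf {m = suc m} g (p ∷ ps) with eq , flip , sums ← arcOf (g ∘ suc) ps =
  cong suc eq , (λ { zero → p ; (suc e) → flip e }) , λ f → trans (cong (f _ +_) (sums f)) (sym (∑-suc _))

module _ {n} (k ℓ : ℕ) (G : Graph n) where
  open Game n k ℓ

  -- Sparsity is applied to the induced subgraph on `U`.
  sparse⇒sparseₗ : Sparse k ℓ G → Sparseₗ (List.tabulate (ends G))
  sparse⇒sparseₗ sparse U pos = begin
    insideₗ U (List.tabulate (ends G)) + ℓ    ≡⟨ cong (_+ ℓ) size ⟨
    ∣ tabulate X ∣ + ℓ                        ≤⟨ sparse (tabulate U) (tabulate X) sub (≤-trans pos (≤-reflexive (sym size))) ⟩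
    k * ∣ tabulate U ∣                        ≡⟨ cong (k *_) (card-tabulate U) ⟩
    k * card U                                ∎
    where
    open ≤-Reasoning
    X : Fin (m G) → Bool
    X e = U (proj₁ (ends G e)) ∧ U (proj₂ (ends G e))
    card-tabulate : ∀ {n} (V : Fin n → Bool) → ∣ tabulate V ∣ ≡ card V
    card-tabulate V = trans (card-lookup (tabulate V)) (∑-cong λ x → cong χ (lookup∘tabulate V x))
    size : ∣ tabulate X ∣ ≡ insideₗ U (List.tabulate (ends G))
    size = trans (card-tabulate X) (sym (∑ₗ-tabulate (λ e → χ (U (proj₁ e) ∧ U (proj₂ e))) (ends G)))
    member : ∀ x → U x ≡ true → x ∈ tabulate U
    member x x∈ = lookup⇒[]= x (tabulate U) (trans (lookup∘tabulate U x) x∈)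
    sub : IsSubgraph G (tabulate U) (tabulate X)
    sub e e∈ with p , q ← ∧-elim (U (proj₁ (ends G e))) (trans (sym (lookup∘tabulate X e)) ([]=⇒lookup e∈)) =
      member _ p , member _ q

  sparse⇒pebbleGameGraph : Sparse k ℓ G → PebbleGameGraph k ℓ G
  sparse⇒pebbleGameGraph sparse =
    let eq , flip , _ = arcOf (ends G) (flips C)
    in ⟨ arcs C , pebbles C ⟩ , reachable C ,
       mk↔ₛ′ (cast eq) (cast (sym eq)) (cast-involutive eq (sym eq)) (cast-involutive (sym eq) eq) , flip
    where
    open Config
    C = build (List.tabulate (ends G)) (sparse⇒sparseₗ sparse)

tight⇒mapsAndTrees : ∀ {n} (q ℓ : ℕ) (G : Graph n) → Tight (ℓ + q) ℓ G → MapsAndTrees (ℓ + q) ℓ G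
-- A spanning tree needs a vertex, but without vertices tightness forces `ℓ` to be 0, so there are
-- no tree classes, and the map classes are vacuous.
tight⇒mapsAndTrees {zero} q ℓ G (_ , count) = (λ e → noVertex (proj₁ (ends G e))) ,
  (λ i lt → contradiction (subst (toℕ i <_) ℓ≡0 lt) λ ()) ,
  λ i _ → (λ e → proj₁ (ends G e)) , (λ e _ → noVertex (proj₁ (ends G e))) , λ ()
  where
  noVertex : ∀ {A : Set} → Fin 0 → A
  noVertex ()
  ℓ≡0 : ℓ ≡ 0
  ℓ≡0 = m+n≡0⇒n≡0 (m G) (trans count (*-zeroʳ (ℓ + q)))
tight⇒mapsAndTrees {suc n} q ℓ G (sparse , count) = decompose G tl hd flip r q ℓ connected degree
  where
  open Game (suc n) (ℓ + q) ℓ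
  open Config
  r : Fin (suc n)
  r = zero
  k = ℓ + q
  L = List.tabulate (ends G)

  sparseₗ : Sparseₗ L
  sparseₗ = sparse⇒sparseₗ k ℓ G sparse

  -- Sparsity speaks only of sets with an edge inside. For other nonempty sets the bound is ℓ ≤ k ≤
  -- k|S|.
  sparse-nonempty : ∀ S x → S x ≡ true → insideₗ S L + ℓ ≤ k * card S
  sparse-nonempty S x x∈ with insideₗ S L | sparseₗ S
  ... | suc _ | bound = bound (s≤s z≤n)
  ... | zero  | _     = begin
        ℓ             ≤⟨ m≤m+n ℓ q ⟩
        k             ≡⟨ *-identityʳ k ⟨
        k * 1         ≤⟨ *-monoʳ-≤ k (∃⇒card-positive S x x∈) ⟩
        k * card S    ∎
    where open ≤-Reasoning

  -- The pair of `r` with itself is the single vertex `r`.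
  gathered = gather r r ℓ (λ S r∈ _ → sparse-nonempty S r r∈) (build L sparseₗ)
  C = proj₁ gathered

  oriented-arcs = arcOf (ends G) (flips C)
  arc-at : Fin (m G) → Fin (suc n) × Fin (suc n) × Fin k
  arc-at e = List.lookup (arcs C) (cast (proj₁ oriented-arcs) e)
  tl hd : Fin (m G) → Fin (suc n)
  tl e = proj₁ (arc-at e)
  hd e = proj₁ (proj₂ (arc-at e))
  flip : ∀ e → Joins G e (tl e) (hd e)
  flip = proj₁ (proj₂ oriented-arcs)
  ∑ₗ-arcs : ∀ f → ∑ₗ f (arcs C) ≡ ∑ (f ∘ arc-at)
  ∑ₗ-arcs = proj₂ (proj₂ oriented-arcs)

  open Branching tl hd

  all : Fin (m G) → Bool
  all _ = true

  out-balance : ∀ v → total C v + outdeg all v ≡ k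
  out-balance v = trans (cong (total C v +_) (sym (∑ₗ-arcs (λ a → χ (v == proj₁ a))))) (balance C v)

  -- Summing the balance over all vertices, pebbles and edges together number k times the number of
  -- vertices; tightness leaves exactly `ℓ` for the pebbles.
  ∑-total : ∑ (total C) ≡ ℓ
  ∑-total = +-cancelʳ-≡ (m G) _ _ (begin
    ∑ (total C) + m G                      ≡⟨ cong (∑ (total C) +_) (trans (sym (card-full (m G))) (card-fibres all tl)) ⟩
    ∑ (total C) + ∑ (outdeg all)           ≡⟨ ∑-+ (total C) (outdeg all) ⟨
    ∑ (λ v → total C v + outdeg all v)     ≡⟨ ∑-cong out-balance ⟩
    ∑ {suc n} (λ _ → k)                    ≡⟨ ∑-const (suc n) k ⟩
    suc n * k                              ≡⟨ *-comm (suc n) k ⟩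
    k * suc n                              ≡⟨ count ⟨
    m G + ℓ                                ≡⟨ +-comm (m G) ℓ ⟩
    ℓ + m G                                ∎)
    where open ≡-Reasoning

  total-root : total C r ≡ ℓ
  total-root = ≤-antisym (≤-trans (pebOnSet≤∑ (pebbles C) r r) (≤-reflexive ∑-total)) (proj₂ gathered)

  total-other : ∀ v → v ≢ r → total C v ≡ 0
  total-other v v≢r = n≤0⇒n≡0 (+-cancelʳ-≤ ℓ _ _ (begin
    total C v + ℓ               ≡⟨ cong (total C v +_) total-root ⟨
    total C v + total C r       ≡⟨ pair-total ⟨
    pebOnSet (pebbles C) v r    ≤⟨ pebOnSet≤∑ (pebbles C) v r ⟩
    ∑ (total C)                 ≡⟨ ∑-total ⟩
    ℓ                           ∎))
    where
    open ≤-Reasoning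
    pair-total : pebOnSet (pebbles C) v r ≡ total C v + total C r
    pair-total with v ≟ r
    ... | yes eq = contradiction eq v≢r
    ... | no _   = refl

  degree-other : ∀ v → v ≢ r → outdeg all v ≡ k
  degree-other v v≢r = trans (cong (_+ outdeg all v) (sym (total-other v v≢r))) (out-balance v)

  degree : ∀ v → outdeg all v ≡ q + ℓ * χ (not (v == r))
  degree v = by-cases (v ≟ r)
    where
    open ≡-Reasoning
    by-cases : Dec (v ≡ r) → outdeg all v ≡ q + ℓ * χ (not (v == r))
    by-cases (yes refl) = +-cancelˡ-≡ ℓ _ _ (begin
      ℓ + outdeg all r                ≡⟨ cong (_+ outdeg all r) total-root ⟨
      total C r + outdeg all r        ≡⟨ out-balance r ⟩
      ℓ + q                           ≡⟨ cong (ℓ +_) (+-identityʳ q) ⟨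
      ℓ + (q + 0)                     ≡⟨ cong (λ z → ℓ + (q + z)) (*-zeroʳ ℓ) ⟨
      ℓ + (q + ℓ * χ (not (r == r)))  ∎)
    by-cases (no v≢r) = begin
      outdeg all v                    ≡⟨ degree-other v v≢r ⟩
      ℓ + q                           ≡⟨ +-comm ℓ q ⟩
      q + ℓ                           ≡⟨ cong (q +_) (*-identityʳ ℓ) ⟨
      q + ℓ * 1                       ≡⟨ cong (λ b → q + ℓ * χ (not b)) (≢⇒== v≢r) ⟨
      q + ℓ * χ (not (v == r))        ∎

  -- Since `U` avoids `r`, all its vertices have out-degree `k`, so k|U| arcs start in `U`. By
  -- sparsity at most k|U| - ℓ of them also end there.
  connected : RootConnected r ℓ all
  connected U x x∈ r∉ = +-cancelˡ-≤ (insideₗ U L) _ _ (begin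
    insideₗ U L + ℓ                                                     ≤⟨ sparse-nonempty U x x∈ ⟩
    k * card U                                                          ≡⟨ ∑-χ-* U k ⟨
    ∑ (λ v → χ (U v) * k)                                               ≡⟨ ∑-cong full-degree ⟨
    ∑ (λ v → χ (U v) * outₗ v (arcs C))                                 ≡⟨ ∑-outₗ U (arcs C) ⟩
    ∑ₗ (λ a → χ (U (proj₁ a))) (arcs C)                                 ≡⟨ ∑ₗ-arcs (λ a → χ (U (proj₁ a))) ⟩
    ∑ (λ e → χ (U (tl e)))                                              ≡⟨ ∑-cong (λ e → split (U (tl e)) (U (hd e))) ⟩
    ∑ (λ e → χ (U (tl e) ∧ U (hd e)) + χ (leaving U e))                 ≡⟨ ∑-+ (λ e → χ (U (tl e) ∧ U (hd e))) (λ e → χ (leaving U e)) ⟩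
    ∑ (λ e → χ (U (tl e) ∧ U (hd e))) + cut all U                       ≡⟨ cong (_+ cut all U) (trans (insideₗ-flip U (flips C)) (∑ₗ-arcs (λ a → χ (U (proj₁ a) ∧ U (proj₁ (proj₂ a)))))) ⟨
    insideₗ U L + cut all U                                             ∎)
    where
    open ≤-Reasoning
    split : ∀ a b → χ a ≡ χ (a ∧ b) + χ (a ∧ not b)
    split true  true  = refl
    split true  false = refl
    split false _     = refl
    full-degree : ∀ v → χ (U v) * outₗ v (arcs C) ≡ χ (U v) * k
    full-degree v with U v in v∈
    ... | false = refl
    ... | true  = cong (_+ 0) (trans (∑ₗ-arcs (λ a → χ (v == proj₁ a))) (degree-other v λ { refl → true≢false v∈ r∉ }))

theorem3 : ∀ (k ℓ : ℕ) → ℓ ≤ k → ∀ {n} (G : Graph n) →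
    (PebbleGameGraph k ℓ G × Tight k ℓ G) ⇔ MapsAndTrees k ℓ G
theorem3 k ℓ ℓ≤k G = mk⇔ only-if if
  where
  only-if : PebbleGameGraph k ℓ G × Tight k ℓ G → MapsAndTrees k ℓ G
  -- Writing `k` as `ℓ + q` gives the number of maps as `q`, free of truncated subtraction.
  only-if (_ , tight) with q , refl ← m≤n⇒∃[o]m+o≡n ℓ≤k = tight⇒mapsAndTrees q ℓ G tight
  if : MapsAndTrees k ℓ G → PebbleGameGraph k ℓ G × Tight k ℓ G
  if mt with tight@(sparse , _) ← mapsAndTrees-tight ℓ≤k mt = sparse⇒pebbleGameGraph k ℓ G sparse , tight
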